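{- Let $k \geq 1$ be an integer and let $G=(V,E)$ be a $k$-connected graph with $n \geq 9$ vertices, $e$ edges, minimum degree $\delta$ and maximum degree $\Delta$. If any one of the following five conditions holds, then $G$ is traceable: [1] $$Z_1(G) \geq (n - k - 2)\Delta^2 + \frac{e^2}{2(k + 2)} + \frac{(k + 2) \Delta^3}{2 \delta};$$ [2] $$F(G) \leq (n - k - 2) \delta^3 + \frac{\delta (2 (k + 2)^2 \delta^2 - e^2)}{k + 2};$$ [3] $$F(G) \leq (n - k - 2) \delta^3 + \frac{\delta}{k + 2} \left( 2 (k + 2) \left((k + 2) \delta^2 + \frac{e^2}{n - k - 2}\right) - e^2 - 2 (k + 2) (n - k - 2) \Delta^2\right);$$ [4] $$Inv(G) \leq \frac{n - k - 2}{\Delta} + \frac{2 (k + 2)^2 \delta^2 - e^2}{(k + 2) \Delta^3};$$ [5] $$Inv(G) \leq \frac{n - k - 2}{\Delta} + \frac{1}{(k + 2) \Delta^3} \left( 2 (k + 2) \left((k + 2) \delta^2 + \frac{e^2}{n - k - 2}\right) - e^2 - 2 (k + 2) (n - k - 2) \Delta^2\right).$$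
   Context: Graphs are finite, undirected, without loops or multiple edges. $d(u)$ denotes the degree of vertex $u$; $\delta$ and $\Delta$ are the minimum and maximum degrees. The first Zagreb index is $Z_1(G)=\sum_{u\in V} d(u)^2$, the forgotten topological index is $F(G)=\sum_{u\in V} d(u)^3$, and the inverse degree is $Inv(G)=\sum_{u\in V}\frac{1}{d(u)}$. A graph is traceable if it has a path containing all its vertices. -}

module Defs where

open import Algebra.Properties.CommutativeMonoid.Sum using (sum)
open import Data.Fin.Base as Fin using (Fin)
import Data.Fin.Properties as Fin
open import Data.Fin.Subset using (Subset; ∣_∣; _∉_)
open import Data.Integer.Base using (+_)
open import Data.List.Base using (List; allFin; cartesianProduct; filter; head; last; length; map)
open import Data.List.Extrema.Nat using (max; min)
open import Data.List.Membership.Propositional using (_∈_)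
open import Data.List.Relation.Unary.All using (All)
open import Data.List.Relation.Unary.Linked using (Linked)
open import Data.List.Relation.Unary.Unique.Propositional using (Unique)
open import Data.Maybe.Base using (just)
open import Data.Nat.Base as ℕ using (ℕ; _<_; _^_)
import Data.Nat.Properties as ℕ
open import Data.Product.Base using (_×_; _,_; ∃)
open import Data.Rational.Base as ℚ using (ℚ; 0ℚ; 1ℚ)
import Data.Rational.Properties as ℚ
open import Level using (0ℓ)
open import Relation.Binary.Core using (Rel)
open import Relation.Binary.Definitions using (Decidable; Symmetric)
open import Relation.Binary.PropositionalEquality.Core using (_≡_)
open import Relation.Nullary.Decidable.Core using (yes; no; _×-dec_)
open import Relation.Nullary.Negation.Core using (¬_)

fromℕ : ℕ → ℚ
fromℕ m = + m ℚ./ 1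

infixl 7 _÷₀_

-- Division made total by the convention p ÷₀ 0 = 0.
_÷₀_ : ℚ → ℚ → ℚ
p ÷₀ q with q ℚ.≟ 0ℚ
... | yes _   = 0ℚ
... | no  q≢0 = ℚ._÷_ p q {{ℚ.≢-nonZero q≢0}}

record Graph (n : ℕ) : Set₁ where
  infix 4 _~_ _~?_
  field
    _~_    : Rel (Fin n) 0ℓ
    _~?_   : Decidable _~_
    ~-sym  : Symmetric _~_
    ~-irrefl : ∀ {u} → ¬ (u ~ u)

module _ {n : ℕ} (G : Graph n) where
  open Graph G

  degree : Fin n → ℕ
  degree u = length (filter (u ~?_) (allFin n))

  -- Each undirected edge is counted once, as the pair (u , v) with u < v.
  edgeCount : ℕ
  edgeCount = length (filter (λ (u , v) → (u Fin.<? v) ×-dec (u ~? v))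
                             (cartesianProduct (allFin n) (allFin n)))

  -- The first argument of min is an upper cut-off; every degree is below n,
  -- so it only matters for the graph without vertices.
  minDegree : ℕ
  minDegree = min n (map degree (allFin n))

  maxDegree : ℕ
  maxDegree = max 0 (map degree (allFin n))

  firstZagreb : ℕ
  firstZagreb = sum ℕ.+-0-commutativeMonoid (λ u → degree u ^ 2)

  forgotten : ℕ
  forgotten = sum ℕ.+-0-commutativeMonoid (λ u → degree u ^ 3)

  inverseDegree : ℚ
  inverseDegree = sum ℚ.+-0-commutativeMonoid (λ u → 1ℚ ÷₀ fromℕ (degree u))

  IsPath : List (Fin n) → Set
  IsPath p = Linked _~_ p × Unique p

  PathAvoiding : Subset n → Fin n → Fin n → Set
  PathAvoiding X u v =
    ∃ λ p → IsPath p × head p ≡ just u × last p ≡ just v × All (_∉ X) p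

  -- More than k vertices, and deleting fewer than k vertices leaves a
  -- connected graph; in particular the complete graph on n vertices is
  -- (n - 1)-connected but not n-connected.
  Connected : ℕ → Set
  Connected k = k < n ×
    (∀ (X : Subset n) → ∣ X ∣ < k → ∀ {u v} → u ∉ X → v ∉ X → PathAvoiding X u v)

  Traceable : Set
  Traceable = ∃ λ p → IsPath p × (∀ v → v ∈ p)

{-# OPTIONS --safe #-}

-- Write s = k + 2. A longest-path argument (Chvátal–Erdős) shows that a k-connected graph is
-- traceable or has an independent set I of s vertices. In the second case the degree sum over I
-- lies between s δ and e, and e ≤ (n - s) Δ since I carries at most half of the total; each
-- of the five conditions then forces all the estimates to be equalities: G is δ-regular and
-- e = s δ. Hence every edge has exactly one end in I and n = 2 s, so G is a balanced bipartite
-- graph with s ≥ 5 vertices on each side, in which every vertex, having degree at least k, misses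
-- at most two vertices of the opposite side. Such a graph is traceable (Moon–Moser): a cyclic
-- alternating arrangement of the vertices with the fewest non-adjacent consecutive pairs has none.

module Submission where

import Algebra.Properties.CommutativeMonoid.Sum as CommutativeMonoidSum
import Algebra.Properties.Semiring.Sum as SemiringSum
open import Data.Bool.Base using (Bool; true; false; not)
import Data.Bool.Properties as Bool
open import Data.Fin.Base as Fin using (Fin; zero; suc)
import Data.Fin.Properties as Fin
open import Data.Fin.Subset using (Subset; ∣_∣; _∪_; ⁅_⁆; ⊥; inside; outside)
import Data.Fin.Subset as Subset
import Data.Fin.Subset.Properties as Subset
import Data.Integer.Base as ℤ
import Data.Integer.Properties as ℤ
open import Data.List.Base using (List; []; _∷_; _++_; length; map; head; last; reverse; filter; tabulate; allFin; cartesianProduct)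
import Data.List.Extrema.Nat as Extrema
open import Data.List.Membership.Propositional using (_∈_; _∉_)
import Data.List.Membership.Propositional.Properties as ∈
import Data.List.Properties as List
open import Data.List.Relation.Binary.Permutation.Propositional using (_↭_; ↭⇒↭ₛ; prep; ↭-refl; ↭-sym; ↭-trans; ↭-reflexive)
import Data.List.Relation.Binary.Permutation.Propositional.Properties as ↭
import Data.List.Relation.Binary.Permutation.Setoid.Properties as ↭ₛ
open import Data.List.Relation.Binary.Subset.Propositional using (_⊆_)
open import Data.List.Relation.Unary.All as All using (All; []; _∷_)
import Data.List.Relation.Unary.All.Properties as All
open import Data.List.Relation.Unary.AllPairs as AllPairs using (AllPairs; []; _∷_)
import Data.List.Relation.Unary.AllPairs.Properties as AllPairs
open import Data.List.Relation.Unary.Any using (here; there)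
import Data.List.Relation.Unary.Any.Properties as Any
open import Data.List.Relation.Unary.Linked using (Linked; []; [-]; _∷_)
open import Data.List.Relation.Unary.Unique.Propositional using (Unique)
import Data.List.Relation.Unary.Unique.Propositional.Properties as Unique
open import Data.Maybe.Base using (just)
open import Data.Maybe.Properties using (just-injective)
open import Data.Nat.Base as ℕ using (ℕ; zero; suc; z≤n; s≤s)
import Data.Nat.ListAction as ℕ
import Data.Nat.ListAction.Properties as ℕ
import Data.Nat.Properties as ℕ
import Data.Nat.Solver
open import Data.Product.Base using (_×_; _,_; proj₁; proj₂; ∃; ∃₂)
open import Data.Rational.Base as ℚ using (0ℚ; toℚᵘ)
import Data.Rational.Properties as ℚ
import Data.Rational.Solver
open import Data.Rational.Unnormalised.Base as ℚᵘ using (mkℚᵘ)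
import Data.Rational.Unnormalised.Properties as ℚᵘ
open import Data.Sum.Base using (_⊎_; inj₁; inj₂; [_,_]′)
open import Data.Vec.Base using ([]; _∷_)
open import Function.Base using (_∘_; id; case_of_)
open import Level using (0ℓ)
open import Relation.Binary.Core using (Rel)
open import Relation.Binary.Definitions using (tri<; tri≈; tri>)
open import Relation.Binary.PropositionalEquality
open import Relation.Nullary using (¬_; Dec; yes; no; does; contradiction; ¬?; _×-dec_)
open import Relation.Unary using (Pred; Decidable)
open import Defs

open SemiringSum ℕ.+-*-semiring using (sum; sum-cong-≗; ∑-distrib-+; ∑-comm; *-distribˡ-sum; *-distribʳ-sum)

-- Were the five inequalities strict, they would contradict the estimates on I at once; because
-- equality is allowed, the balanced bipartite graphs remain to be treated. With r = n - s, each
-- condition reverses a bound valid for every graph carrying I. The condition on Z₁: Z₁ ≤ r Δ² + Δ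
-- e, and Δ e ≤ e²/(2s) + s Δ²/2 by the inequality of arithmetic and geometric means, while Δ² ≤
-- Δ³/δ. The first condition on F: n δ³ ≤ F, and e ≥ s δ brings the right side down to at most n δ³.
-- The first condition on Inv: n/Δ ≤ Inv, and e ≥ s δ with δ ≤ Δ brings the right side down to at
-- most n/Δ. The second condition on F, or on Inv, implies the first one, because e ≤ r Δ gives e²/r
-- ≤ r Δ². In the bipartite case n = 2 s ≥ 9 gives s ≥ 5, more than the 2 + 2 non-neighbours that
-- the two ends of an arrangement can have together; this is what makes an exchange possible.

module _ where
  open import Data.Nat.Base using (_+_; _*_; _^_; _≤_; _<_)

  -- Counting by sums of indicators

  𝟙 : ∀ {a} {P : Set a} → Dec P → ℕ
  𝟙 (yes _) = 1
  𝟙 (no _)  = 0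

  𝟙-mono : ∀ {a b} {P : Set a} {Q : Set b} (P? : Dec P) (Q? : Dec Q) → (P → Q) → 𝟙 P? ≤ 𝟙 Q?
  𝟙-mono (yes p) (yes q) f = ℕ.≤-refl
  𝟙-mono (yes p) (no ¬q) f = contradiction (f p) ¬q
  𝟙-mono (no ¬p) _       f = z≤n

  𝟙-cong : ∀ {a b} {P : Set a} {Q : Set b} (P? : Dec P) (Q? : Dec Q) → (P → Q) → (Q → P) → 𝟙 P? ≡ 𝟙 Q?
  𝟙-cong P? Q? f g = ℕ.≤-antisym (𝟙-mono P? Q? f) (𝟙-mono Q? P? g)

  𝟙-yes : ∀ {a} {P : Set a} (P? : Dec P) → P → 𝟙 P? ≡ 1
  𝟙-yes (yes _) p = refl
  𝟙-yes (no ¬p) p = contradiction p ¬p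

  𝟙-no : ∀ {a} {P : Set a} (P? : Dec P) → ¬ P → 𝟙 P? ≡ 0
  𝟙-no (yes p) ¬p = contradiction p ¬p
  𝟙-no (no _)  ¬p = refl

  𝟙≤1 : ∀ {a} {P : Set a} (P? : Dec P) → 𝟙 P? ≤ 1
  𝟙≤1 (yes _) = ℕ.≤-refl
  𝟙≤1 (no _)  = z≤n

  sum-mono : ∀ {n} (f g : Fin n → ℕ) → (∀ i → f i ≤ g i) → sum f ≤ sum g
  sum-mono {zero}  f g f≤g = z≤n
  sum-mono {suc n} f g f≤g = ℕ.+-mono-≤ (f≤g zero) (sum-mono (f ∘ suc) (g ∘ suc) (f≤g ∘ suc))

  -- Turns equality of totals into equality of terms. It yields regularity from the conditions on F,
  -- and from e = s δ that every edge has exactly one end in the independent set.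
  sum-tight : ∀ {n} (f g : Fin n → ℕ) → (∀ i → f i ≤ g i) → sum g ≤ sum f → ∀ i → f i ≡ g i
  sum-tight {suc n} f g f≤g Σg≤Σf zero = ℕ.≤-antisym (f≤g zero)
    (ℕ.+-cancelʳ-≤ (sum (g ∘ suc)) _ _
      (ℕ.≤-trans Σg≤Σf (ℕ.+-monoʳ-≤ (f zero) (sum-mono _ _ (f≤g ∘ suc)))))
  sum-tight {suc n} f g f≤g Σg≤Σf (suc i) = sum-tight (f ∘ suc) (g ∘ suc) (f≤g ∘ suc)
    (ℕ.+-cancelˡ-≤ (g zero) _ _ (ℕ.≤-trans Σg≤Σf (ℕ.+-monoˡ-≤ _ (f≤g zero)))) i

  sum-const : ∀ n c → sum {n} (λ _ → c) ≡ n * c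
  sum-const zero    c = refl
  sum-const (suc n) c = cong (c +_) (sum-const n c)

  sum-single : ∀ {n} (x : Fin n) → sum (λ u → 𝟙 (u Fin.≟ x)) ≡ 1
  sum-single {suc n} zero = cong suc (trans (sum-cong-≗ {n} {λ u → 𝟙 (suc u Fin.≟ zero)} {λ _ → 0} (λ _ → refl))
    (trans (sum-const n 0) (ℕ.*-zeroʳ n)))
  sum-single {suc n} (suc x) = trans (sum-cong-≗ {n} {λ u → 𝟙 (suc u Fin.≟ suc x)} {λ u → 𝟙 (u Fin.≟ x)}
    (λ u → 𝟙-cong (suc u Fin.≟ suc x) (u Fin.≟ x) Fin.suc-injective (cong suc))) (sum-single x)

  module _ {n : ℕ} where
    open import Data.List.Membership.DecPropositional (Fin._≟_ {n}) using (_∈?_)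

    sum-∈-∷≤ : ∀ x xs → sum (λ u → 𝟙 (u ∈? (x ∷ xs))) ≤ suc (sum (λ u → 𝟙 (u ∈? xs)))
    sum-∈-∷≤ x xs = begin
      sum (λ u → 𝟙 (u ∈? (x ∷ xs)))                        ≤⟨ sum-mono _ _ split ⟩
      sum (λ u → 𝟙 (u Fin.≟ x) + 𝟙 (u ∈? xs))              ≡⟨ ∑-distrib-+ (λ u → 𝟙 (u Fin.≟ x)) (λ u → 𝟙 (u ∈? xs)) ⟩
      sum (λ u → 𝟙 (u Fin.≟ x)) + sum (λ u → 𝟙 (u ∈? xs))  ≡⟨ cong (_+ _) (sum-single x) ⟩
      suc (sum (λ u → 𝟙 (u ∈? xs)))                        ∎
      where
      open ℕ.≤-Reasoning
      split : ∀ u → 𝟙 (u ∈? (x ∷ xs)) ≤ 𝟙 (u Fin.≟ x) + 𝟙 (u ∈? xs)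
      split u with u ∈? (x ∷ xs)
      ... | no _                = z≤n
      ... | yes (here u≡x)      = ℕ.≤-trans (ℕ.≤-reflexive (sym (𝟙-yes (u Fin.≟ x) u≡x))) (ℕ.m≤m+n _ _)
      ... | yes (there u∈xs)    = ℕ.≤-trans (ℕ.≤-reflexive (sym (𝟙-yes (u ∈? xs) u∈xs))) (ℕ.m≤n+m _ _)

    sum-∈≤length : ∀ xs → sum (λ u → 𝟙 (u ∈? xs)) ≤ length xs
    sum-∈≤length []       = ℕ.≤-reflexive (trans (sum-const n 0) (ℕ.*-zeroʳ n))
    sum-∈≤length (x ∷ xs) = ℕ.≤-trans (sum-∈-∷≤ x xs) (s≤s (sum-∈≤length xs))

    length≤sum-∈ : ∀ {xs} → Unique xs → length xs ≤ sum (λ u → 𝟙 (u ∈? xs))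
    length≤sum-∈ {[]}     []           = z≤n
    length≤sum-∈ {x ∷ xs} (x∉xs ∷ xs!) = begin
      suc (length xs)                                      ≤⟨ s≤s (length≤sum-∈ xs!) ⟩
      suc (sum (λ u → 𝟙 (u ∈? xs)))                        ≡⟨ cong (_+ _) (sum-single x) ⟨
      sum (λ u → 𝟙 (u Fin.≟ x)) + sum (λ u → 𝟙 (u ∈? xs))  ≡⟨ ∑-distrib-+ (λ u → 𝟙 (u Fin.≟ x)) (λ u → 𝟙 (u ∈? xs)) ⟨
      sum (λ u → 𝟙 (u Fin.≟ x) + 𝟙 (u ∈? xs))              ≤⟨ sum-mono _ _ join ⟩
      sum (λ u → 𝟙 (u ∈? (x ∷ xs)))                        ∎
      where
      open ℕ.≤-Reasoning
      join : ∀ u → 𝟙 (u Fin.≟ x) + 𝟙 (u ∈? xs) ≤ 𝟙 (u ∈? (x ∷ xs))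
      join u = by-cases (u Fin.≟ x)
        where
        by-cases : (u≟x : Dec (u ≡ x)) → 𝟙 u≟x + 𝟙 (u ∈? xs) ≤ 𝟙 (u ∈? (x ∷ xs))
        by-cases (no _)     = 𝟙-mono (u ∈? xs) (u ∈? (x ∷ xs)) there
        by-cases (yes refl) = ℕ.≤-reflexive (trans
          (cong suc (𝟙-no (x ∈? xs) (λ x∈ → All.lookup x∉xs x∈ refl)))
          (sym (𝟙-yes (x ∈? (x ∷ xs)) (here refl))))

    sum-∈ : ∀ {xs} → Unique xs → sum (λ u → 𝟙 (u ∈? xs)) ≡ length xs
    sum-∈ xs! = ℕ.≤-antisym (sum-∈≤length _) (length≤sum-∈ xs!)

    length-unique≤ : ∀ {xs : List (Fin n)} → Unique xs → length xs ≤ n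
    length-unique≤ {xs} xs! = begin
      length xs                 ≤⟨ length≤sum-∈ xs! ⟩
      sum (λ u → 𝟙 (u ∈? xs))   ≤⟨ sum-mono _ _ (λ u → 𝟙≤1 (u ∈? xs)) ⟩
      sum {n} (λ _ → 1)         ≡⟨ sum-const n 1 ⟩
      n * 1                     ≡⟨ ℕ.*-identityʳ n ⟩
      n                         ∎
      where open ℕ.≤-Reasoning

    length-cover≥ : ∀ (xs : List (Fin n)) → (∀ u → u ∈ xs) → n ≤ length xs
    length-cover≥ xs all = begin
      n                         ≡⟨ ℕ.*-identityʳ n ⟨
      n * 1                     ≡⟨ sum-const n 1 ⟨
      sum {n} (λ _ → 1)         ≤⟨ sum-mono _ _ (λ u → ℕ.≤-reflexive (sym (𝟙-yes (u ∈? xs) (all u)))) ⟩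
      sum (λ u → 𝟙 (u ∈? xs))   ≤⟨ sum-∈≤length xs ⟩
      length xs                 ∎
      where open ℕ.≤-Reasoning

  sumOver : ∀ {a} {A : Set a} → (A → ℕ) → List A → ℕ
  sumOver f xs = ℕ.sum (map f xs)

  module _ {a} {A : Set a} where

    sumOver-++ : ∀ (f : A → ℕ) xs ys → sumOver f (xs ++ ys) ≡ sumOver f xs + sumOver f ys
    sumOver-++ f xs ys = trans (cong ℕ.sum (List.map-++ f xs ys)) (ℕ.sum-++ (map f xs) (map f ys))

    sumOver-↭ : ∀ (f : A → ℕ) {xs ys} → xs ↭ ys → sumOver f xs ≡ sumOver f ys
    sumOver-↭ f xs↭ys = ℕ.sum-↭ (↭.map⁺ f xs↭ys)

    sumOver-tabulate : ∀ {n} (f : A → ℕ) (g : Fin n → A) → sumOver f (tabulate g) ≡ sum (f ∘ g)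
    sumOver-tabulate {zero}  f g = refl
    sumOver-tabulate {suc n} f g = cong (f (g zero) +_) (sumOver-tabulate f (g ∘ suc))

    length-filter : ∀ {p} {P : Pred A p} (P? : Decidable P) xs → length (filter P? xs) ≡ sumOver (𝟙 ∘ P?) xs
    length-filter P? [] = refl
    length-filter P? (x ∷ xs) with P? x
    ... | yes _ = cong suc (length-filter P? xs)
    ... | no _  = length-filter P? xs

  sumOver-cartesianProduct : ∀ {a b} {A : Set a} {B : Set b} (f : A × B → ℕ) xs ys →
    sumOver f (cartesianProduct xs ys) ≡ sumOver (λ x → sumOver (λ y → f (x , y)) ys) xs
  sumOver-cartesianProduct f []       ys = refl
  sumOver-cartesianProduct f (x ∷ xs) ys = trans
    (sumOver-++ f (map (x ,_) ys) (cartesianProduct xs ys))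
    (cong₂ _+_ (cong ℕ.sum (sym (List.map-∘ ys))) (sumOver-cartesianProduct f xs ys))

  length-filter-allFin : ∀ {n p} {P : Pred (Fin n) p} (P? : Decidable P) →
    length (filter P? (allFin n)) ≡ sum (𝟙 ∘ P?)
  length-filter-allFin {n} P? = trans (length-filter P? (allFin n)) (sumOver-tabulate (𝟙 ∘ P?) id)

  -- Lists as subsets, and cuts of lists

  ∣p∪q∣≤∣p∣+∣q∣ : ∀ {n} (p q : Subset n) → ∣ p ∪ q ∣ ≤ ∣ p ∣ + ∣ q ∣
  ∣p∪q∣≤∣p∣+∣q∣ []            []            = z≤n
  ∣p∪q∣≤∣p∣+∣q∣ (inside  ∷ p) (inside  ∷ q) = s≤s (ℕ.≤-trans (∣p∪q∣≤∣p∣+∣q∣ p q) (ℕ.+-monoʳ-≤ ∣ p ∣ (ℕ.n≤1+n ∣ q ∣)))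
  ∣p∪q∣≤∣p∣+∣q∣ (inside  ∷ p) (outside ∷ q) = s≤s (∣p∪q∣≤∣p∣+∣q∣ p q)
  ∣p∪q∣≤∣p∣+∣q∣ (outside ∷ p) (inside  ∷ q) =
    ℕ.≤-trans (s≤s (∣p∪q∣≤∣p∣+∣q∣ p q)) (ℕ.≤-reflexive (sym (ℕ.+-suc ∣ p ∣ ∣ q ∣)))
  ∣p∪q∣≤∣p∣+∣q∣ (outside ∷ p) (outside ∷ q) = ∣p∪q∣≤∣p∣+∣q∣ p q

  toSubset : ∀ {n} → List (Fin n) → Subset n
  toSubset []       = ⊥
  toSubset (x ∷ xs) = ⁅ x ⁆ ∪ toSubset xs

  ∣toSubset∣≤length : ∀ {n} (xs : List (Fin n)) → ∣ toSubset xs ∣ ≤ length xs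
  ∣toSubset∣≤length {n} []   = ℕ.≤-reflexive (Subset.∣⊥∣≡0 n)
  ∣toSubset∣≤length (x ∷ xs) = ℕ.≤-trans (∣p∪q∣≤∣p∣+∣q∣ ⁅ x ⁆ (toSubset xs))
    (ℕ.+-mono-≤ (ℕ.≤-reflexive (Subset.∣⁅x⁆∣≡1 x)) (∣toSubset∣≤length xs))

  ∈-toSubset⁺ : ∀ {n} {x : Fin n} {xs} → x ∈ xs → x Subset.∈ toSubset xs
  ∈-toSubset⁺ {xs = y ∷ xs} (here refl)  = Subset.x∈p∪q⁺ (inj₁ (Subset.x∈⁅x⁆ y))
  ∈-toSubset⁺ {xs = y ∷ xs} (there x∈xs) = Subset.x∈p∪q⁺ {p = ⁅ y ⁆} (inj₂ (∈-toSubset⁺ x∈xs))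

  ∈-toSubset⁻ : ∀ {n} {x : Fin n} xs → x Subset.∈ toSubset xs → x ∈ xs
  ∈-toSubset⁻ []       x∈ = contradiction x∈ Subset.∉⊥
  ∈-toSubset⁻ (y ∷ xs) x∈ with Subset.x∈p∪q⁻ ⁅ y ⁆ (toSubset xs) x∈
  ... | inj₁ x∈⁅y⁆ = here (Subset.x∈⁅y⁆⇒x≡y y x∈⁅y⁆)
  ... | inj₂ x∈xs  = there (∈-toSubset⁻ xs x∈xs)

  -- Orders two cuts of one list, with `ms` the stretch between them. It decides which of two
  -- vertices comes earlier on a path.
  ++-dichotomy : ∀ {a} {A : Set a} (as bs : List A) {cs ds} → as ++ cs ≡ bs ++ ds →
    (∃ λ ms → bs ≡ as ++ ms × cs ≡ ms ++ ds) ⊎ (∃ λ ms → as ≡ bs ++ ms × ds ≡ ms ++ cs)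
  ++-dichotomy []       bs       eq = inj₁ (bs , refl , eq)
  ++-dichotomy (a ∷ as) []       eq = inj₂ (a ∷ as , refl , sym eq)
  ++-dichotomy (a ∷ as) (b ∷ bs) eq with List.∷-injective eq
  ... | refl , eq′ with ++-dichotomy as bs eq′
  ...   | inj₁ (ms , refl , cs≡) = inj₁ (ms , refl , cs≡)
  ...   | inj₂ (ms , refl , ds≡) = inj₂ (ms , refl , ds≡)

  Unique-++-disjoint : ∀ {a} {A : Set a} xs {ys : List A} {x} → Unique (xs ++ ys) → x ∈ xs → x ∉ ys
  Unique-++-disjoint (_ ∷ xs) (x∉ ∷ _)  (here refl)  x∈ys = All.lookup (All.++⁻ʳ xs x∉) x∈ys refl
  Unique-++-disjoint (_ ∷ xs) (_  ∷ u)  (there x∈xs) x∈ys = Unique-++-disjoint xs u x∈xs x∈ys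

  Unique-++⁻ʳ : ∀ {a} {A : Set a} xs {ys : List A} → Unique (xs ++ ys) → Unique ys
  Unique-++⁻ʳ []       u       = u
  Unique-++⁻ʳ (_ ∷ xs) (_ ∷ u) = Unique-++⁻ʳ xs u

  Unique-resp-↭ : ∀ {a} {A : Set a} {xs ys : List A} → xs ↭ ys → Unique xs → Unique ys
  Unique-resp-↭ {A = A} p = ↭ₛ.Unique-resp-↭ (setoid A) (↭⇒↭ₛ p)

  -- Vertex sequences with edges and gaps

  module Arrangements {n : ℕ} (G : Graph n) (_∥_ : Rel (Fin n) 0ℓ) (∥-sym : ∀ {u v} → u ∥ v → v ∥ u) where
    open Graph G

    -- The indices are the first vertex, the vertex list, the last vertex and the number of gaps. A
    -- gap may join adjacent vertices as well, so the index is only an upper bound for the number of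
    -- non-adjacent consecutive pairs. Arrangements without gaps are walks, so joining and reversing
    -- are done once for both uses.
    data Arrangement (a : Fin n) : List (Fin n) → Fin n → ℕ → Set where
      stop : Arrangement a (a ∷ []) a 0
      edge : ∀ {b l c g} → a ~ b → Arrangement b l c g → Arrangement a (a ∷ l) c g
      gap  : ∀ {b l c g} → a ∥ b → Arrangement b l c g → Arrangement a (a ∷ l) c (suc g)

    private variable
      a b c d : Fin n
      l m : List (Fin n)
      g h : ℕ

    start-head : Arrangement a (b ∷ l) c g → a ≡ b
    start-head stop       = refl
    start-head (edge _ _) = refl
    start-head (gap _ _)  = refl

    start∈ : Arrangement a l b g → a ∈ l
    start∈ stop       = here refl
    start∈ (edge _ _) = here refl
    start∈ (gap _ _)  = here refl

    end∈ : Arrangement a l b g → b ∈ l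
    end∈ stop       = here refl
    end∈ (edge _ w) = there (end∈ w)
    end∈ (gap _ w)  = there (end∈ w)

    end-unique : Arrangement a l b g → Arrangement c l d h → b ≡ d
    end-unique stop       stop        = refl
    end-unique (edge _ w) (edge _ w′) = end-unique w w′
    end-unique (edge _ w) (gap _ w′)  = end-unique w w′
    end-unique (gap _ w)  (edge _ w′) = end-unique w w′
    end-unique (gap _ w)  (gap _ w′)  = end-unique w w′

    join : Arrangement a l b g → b ~ c → Arrangement c m d h → Arrangement a (l ++ m) d (g + h)
    join stop       b~c w′ = edge b~c w′
    join (edge e w) b~c w′ = edge e (join w b~c w′)
    join (gap e w)  b~c w′ = gap e (join w b~c w′)

    join-gap : Arrangement a l b g → b ∥ c → Arrangement c m d h → Arrangement a (l ++ m) d (suc (g + h))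
    join-gap stop       b∥c w′ = gap b∥c w′
    join-gap (edge e w) b∥c w′ = edge e (join-gap w b∥c w′)
    join-gap (gap e w)  b∥c w′ = gap e (join-gap w b∥c w′)

    reversed : Arrangement a l b g → Arrangement b (reverse l) a g
    reversed stop = stop
    reversed {a} {_} {b} {g} (edge {l = l} e w) =
      subst₂ (λ l′ g′ → Arrangement b l′ a g′) (sym (List.unfold-reverse a l)) (ℕ.+-identityʳ g)
        (join (reversed w) (~-sym e) stop)
    reversed {a} {_} {b} {suc g} (gap {l = l} e w) =
      subst₂ (λ l′ g′ → Arrangement b l′ a g′) (sym (List.unfold-reverse a l)) (cong suc (ℕ.+-identityʳ g))
        (join-gap (reversed w) (∥-sym e) stop)

    gapless⇒Linked : Arrangement a l b 0 → Linked _~_ l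
    gapless⇒Linked stop                = [-]
    gapless⇒Linked (edge e stop)       = e ∷ [-]
    gapless⇒Linked (edge e (edge f w)) = e ∷ gapless⇒Linked (edge f w)

  -- Walks, loop erasure and first hits

  module Walks {n : ℕ} (G : Graph n) where
    open Graph G
    -- Walks have no gaps, so the choice of the gap relation is immaterial here.
    open Arrangements G _~_ ~-sym public
    open import Data.List.Membership.DecPropositional (Fin._≟_ {n}) using (_∈?_)

    Walk : Fin n → List (Fin n) → Fin n → Set
    Walk a l b = Arrangement a l b 0

    private variable
      a b c : Fin n
      l m : List (Fin n)

    Linked⇒Walk : Linked _~_ l → head l ≡ just a → last l ≡ just b → Walk a l b
    Linked⇒Walk [-] refl refl = stop
    Linked⇒Walk (e ∷ es) refl eq = edge e (Linked⇒Walk es refl eq)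

    drop-walk : ∀ l → Walk a (l ++ c ∷ m) b → Walk c (c ∷ m) b
    drop-walk [] w with start-head w
    ... | refl = w
    drop-walk (_ ∷ []) (edge e w) = drop-walk [] w
    drop-walk (_ ∷ l@(_ ∷ _)) (edge e w) = drop-walk l w

    glue : Walk a l b → Walk b m c → ∃ λ l′ → Walk a l′ c × l′ ⊆ l ++ m
    glue {m = m} stop w = m , w , there
    glue (edge e w) w′ with glue w w′
    ... | l′ , v , l′⊆ = _ , edge e v , λ where
      (here eq)  → here eq
      (there ∈l′) → there (l′⊆ ∈l′)

    suffix-from : c ∈ l → Unique l → Walk a l b → ∃ λ l′ → Walk c l′ b × Unique l′ × l′ ⊆ l
    suffix-from {l = l} (here refl) u w with start-head w
    ... | refl = l , w , u , id
    suffix-from (there c∈) (_ ∷ u) (edge e w) with suffix-from c∈ u w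
    ... | l′ , w′ , u′ , l′⊆ = l′ , w′ , u′ , there ∘ l′⊆

    loop-erase : Walk a l b → ∃ λ l′ → Walk a l′ b × Unique l′ × l′ ⊆ l
    loop-erase stop = _ , stop , [] ∷ [] , id
    loop-erase {a = a} (edge e w) with loop-erase w
    ... | l′ , w′ , u′ , l′⊆ with a ∈? l′
    ...   | yes a∈ with suffix-from a∈ u′ w′
    ...     | l″ , w″ , u″ , l″⊆ = l″ , w″ , u″ , there ∘ l′⊆ ∘ l″⊆
    loop-erase {a = a} (edge e w) | l′ , w′ , u′ , l′⊆ | no a∉ =
      a ∷ l′ , edge e w′ , All.tabulate (λ { x∈ refl → a∉ x∈ }) ∷ u′ , λ where
        (here eq)  → here eq
        (there ∈l′) → there (l′⊆ ∈l′)

    first-hit : ∀ P → Walk a l b → a ∉ P → b ∈ P →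
      ∃ λ Q → ∃₂ λ y t → Walk a Q y × y ~ t × t ∈ P × t ∈ l × All (_∉ P) Q
    first-hit P stop a∉P a∈P = contradiction a∈P a∉P
    first-hit P (edge {b = b} e w) a∉P ∈P with b ∈? P
    ... | yes b∈P = _ , _ , b , stop , e , b∈P , there (start∈ w) , a∉P ∷ []
    ... | no b∉P with first-hit P w b∉P ∈P
    ...   | Q , y , t , w′ , y~t , t∈P , t∈l , Q∉P = _ , y , t , edge e w′ , y~t , t∈P , there t∈l , a∉P ∷ Q∉P

    locate : ∀ {t} → Walk a l b → t ∈ l →
      t ≡ b ⊎ ∃₂ λ pre post → ∃ λ t⁺ → l ≡ pre ++ post × Walk a pre t × t ~ t⁺ × Walk t⁺ post b
    locate stop (here refl) = inj₁ refl
    locate (edge e w) (here refl) = inj₂ (_ , _ , _ , refl , stop , e , w)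
    locate (edge e w) (there t∈) with locate w t∈
    ... | inj₁ t≡b = inj₁ t≡b
    ... | inj₂ (pre , post , t⁺ , refl , w₁ , t~t⁺ , w₂) = inj₂ (_ , post , t⁺ , refl , edge e w₁ , t~t⁺ , w₂)

  -- A longer path or an independent set (Chvátal-Erdős)

  module ChvátalErdős {n : ℕ} (G : Graph n) where
    open Graph G
    open Walks G
    open import Data.List.Membership.DecPropositional (Fin._≟_ {n}) using (_∈?_)

    Independent : List (Fin n) → Set
    Independent = AllPairs (λ u v → u ≢ v × ¬ (u ~ v))

    module FromPath {v w x : Fin n} {P : List (Fin n)} (walkP : Walk v P w) (uniqueP : Unique P) (x∉P : x ∉ P) where

      Longer : Set
      Longer = ∃₂ λ a P′ → ∃ λ b → Walk a P′ b × Unique P′ × length P < length P′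

      -- Every lengthening below rearranges `P` together with a detour `Q` off `P`, so a permutation
      -- is all that has to be checked; `walkQ` serves to show that `Q` is nonempty.
      longer : ∀ {a b c d l Q} → Walk a l b → l ↭ Q ++ P → Walk c Q d → Unique Q → All (_∉ P) Q → Longer
      longer {l = l} {Q} walk l↭ walkQ uniqueQ Q∉P = _ , l , _ , walk ,
        Unique-resp-↭ (↭-sym l↭) (Unique.++⁺ uniqueQ uniqueP (λ (∈Q , ∈P) → All.lookup Q∉P ∈Q ∈P)) ,
        subst (length P <_) (sym (trans (↭.↭-length l↭) (List.length-++ Q)))
          (ℕ.m<n+m (length P) (nonempty walkQ))
        where
        nonempty : ∀ {a b l} → Walk a l b → 0 < length l
        nonempty stop       = s≤s z≤n
        nonempty (edge _ _) = s≤s z≤n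

      record Link (t : Fin n) : Set where
        constructor link
        field
          {Q}     : List (Fin n)
          {y}     : Fin n
          walkQ   : Walk x Q y
          y~t     : y ~ t
          uniqueQ : Unique Q
          Q∉P     : All (_∉ P) Q

      prepend : Link v → Longer
      prepend (link walkQ y~v uniqueQ Q∉P) = longer (join walkQ y~v walkP) ↭-refl walkQ uniqueQ Q∉P

      append : Link w → Longer
      append (link {Q} walkQ y~w uniqueQ Q∉P) = longer (join walkP (~-sym y~w) (reversed walkQ))
        (↭-trans (↭.++⁺ˡ P (↭.↭-reverse Q)) (↭.++-comm P Q)) walkQ uniqueQ Q∉P

      -- A vertex `t` where a link from `x` reaches `P`, kept with its successor `t⁺` on `P`. The
      -- successors of k hits, together with `x` and `v`, will be the independent set.
      record Hit : Set where
        constructor hit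
        field
          {t t⁺}    : Fin n
          pre post  : List (Fin n)
          P≡        : P ≡ pre ++ post
          walk-pre  : Walk v pre t
          t~t⁺      : t ~ t⁺
          walk-post : Walk t⁺ post w
          linked    : Link t

        t∈P : t ∈ P
        t∈P = subst (t ∈_) (sym P≡) (∈.∈-++⁺ˡ (end∈ walk-pre))

        t⁺∈P : t⁺ ∈ P
        t⁺∈P = subst (t⁺ ∈_) (sym P≡) (∈.∈-++⁺ʳ pre (start∈ walk-post))

        v≢t⁺ : v ≢ t⁺
        v≢t⁺ v≡t⁺ = Unique-++-disjoint pre (subst Unique P≡ uniqueP) (start∈ walk-pre)
          (subst (_∈ post) (sym v≡t⁺) (start∈ walk-post))

        -- The new path runs from `x` along `Q` to `t`, back along `pre` to `v`, over to `t⁺` and on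
        -- to `w`.
        rotate : v ~ t⁺ → Longer
        rotate v~t⁺ = longer (join walkQ y~t (join (reversed walk-pre) v~t⁺ walk-post))
          (↭.++⁺ˡ Q (↭-trans (↭.++⁺ʳ post (↭.↭-reverse pre)) (↭-reflexive (sym P≡)))) walkQ uniqueQ Q∉P
          where open Link linked

        -- The link is spliced in between `t` and `t⁺`: it is run backwards, from `y` to `x`.
        insert : x ~ t⁺ → Longer
        insert x~t⁺ = longer (join walk-pre (~-sym y~t) (join (reversed walkQ) x~t⁺ walk-post))
          (↭-trans (↭.shifts pre (reverse Q))
            (↭-trans (↭.++⁺ʳ (pre ++ post) (↭.↭-reverse Q)) (↭.++⁺ˡ Q (↭-reflexive (sym P≡)))))
          walkQ uniqueQ Q∉P
          where open Link linked

      open Hit using (t; t⁺)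

      segment : ∀ (h h′ : Hit) ms → t h ≢ t h′ → Hit.pre h′ ≡ Hit.pre h ++ ms → Hit.post h ≡ ms ++ Hit.post h′ →
        Walk (t⁺ h) ms (t h′)
      -- With nothing between the two cuts the prefixes coincide, and so do their last vertices.
      segment h h′ [] t≢t′ pre≡ _ = contradiction
        (end-unique (Hit.walk-pre h) (subst (λ l → Walk v l (t h′)) (trans pre≡ (List.++-identityʳ _)) (Hit.walk-pre h′)))
        t≢t′
      segment h h′ (m ∷ ms) _ pre≡ post≡
        with start-head (subst (λ l → Walk (t⁺ h) l w) post≡ (Hit.walk-post h))
      ... | refl = drop-walk (Hit.pre h) (subst (λ l → Walk v l (t h′)) pre≡ (Hit.walk-pre h′))

      -- The new path runs from `v` to `t h`, through both links to `t h′`, back along `ms` to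
      -- `t⁺ h`, over to `t⁺ h′` and on to `w`. The two links share `x` and may meet elsewhere, so
      -- their concatenation is loop-erased before it is inserted.
      detour : ∀ (h h′ : Hit) ms → t h ≢ t h′ → Hit.pre h′ ≡ Hit.pre h ++ ms → Hit.post h ≡ ms ++ Hit.post h′ →
        t⁺ h ~ t⁺ h′ → Longer
      detour h h′ ms t≢t′ pre≡ post≡ t⁺~t′⁺
        with glue (reversed (Link.walkQ (Hit.linked h))) (Link.walkQ (Hit.linked h′))
      ... | R , walkR , R⊆ with loop-erase walkR
      ...   | Q , walkQ , uniqueQ , Q⊆ = longer
        (join walk-pre (~-sym H.y~t) (join walkQ H′.y~t (join (reversed (segment h h′ ms t≢t′ pre≡ post≡)) t⁺~t′⁺ (Hit.walk-post h′))))
        (↭-trans (↭.shifts pre Q) (↭.++⁺ˡ Q (↭-trans (↭.++⁺ˡ pre (↭.++⁺ʳ (Hit.post h′) (↭.↭-reverse ms)))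
          (↭-reflexive (trans (cong (pre ++_) (sym post≡)) (sym P≡))))))
        walkQ uniqueQ (All.tabulate (Q∉P ∘ R⊆ ∘ Q⊆))
        where
        open Hit h using (pre; walk-pre; P≡)
        module H = Link (Hit.linked h)
        module H′ = Link (Hit.linked h′)
        Q∉P : ∀ {u} → u ∈ reverse H.Q ++ H′.Q → u ∉ P
        Q∉P u∈ with ∈.∈-++⁻ (reverse H.Q) u∈
        ... | inj₁ u∈Q = All.lookup H.Q∉P (Any.reverse⁻ u∈Q)
        ... | inj₂ u∈Q = All.lookup H′.Q∉P u∈Q

      t⁺-distinct : ∀ (h h′ : Hit) ms → t h ≢ t h′ → Hit.pre h′ ≡ Hit.pre h ++ ms → Hit.post h ≡ ms ++ Hit.post h′ →
        t⁺ h ≢ t⁺ h′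
      t⁺-distinct h h′ ms t≢t′ pre≡ post≡ t⁺≡ = Unique-++-disjoint ms
        (subst Unique post≡ (Unique-++⁻ʳ (Hit.pre h) (subst Unique (Hit.P≡ h) uniqueP)))
        (start∈ (segment h h′ ms t≢t′ pre≡ post≡))
        (subst (_∈ Hit.post h′) (sym t⁺≡) (start∈ (Hit.walk-post h′)))

      Compatible : Hit → Hit → Set
      Compatible h h′ = t⁺ h ≢ t⁺ h′ × ¬ (t⁺ h ~ t⁺ h′)

      compare : ∀ h h′ → t h ≢ t h′ → Longer ⊎ Compatible h h′
      compare h h′ t≢t′
        with ++-dichotomy (Hit.pre h) (Hit.pre h′) (trans (sym (Hit.P≡ h)) (Hit.P≡ h′)) | t⁺ h ~? t⁺ h′
      ... | inj₁ (ms , pre≡ , post≡) | yes adj = inj₁ (detour h h′ ms t≢t′ pre≡ post≡ adj)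
      ... | inj₁ (ms , pre≡ , post≡) | no ¬adj = inj₂ (t⁺-distinct h h′ ms t≢t′ pre≡ post≡ , ¬adj)
      ... | inj₂ (ms , pre≡ , post≡) | yes adj = inj₁ (detour h′ h ms (t≢t′ ∘ sym) pre≡ post≡ (~-sym adj))
      ... | inj₂ (ms , pre≡ , post≡) | no ¬adj = inj₂ (t⁺-distinct h′ h ms (t≢t′ ∘ sym) pre≡ post≡ ∘ sym , ¬adj)

      compareAll : ∀ h hs → t h ∉ map t hs → Longer ⊎ All (Compatible h) hs
      compareAll h []        _ = inj₂ []
      compareAll h (h′ ∷ hs) t∉ with compare h h′ (t∉ ∘ here) | compareAll h hs (t∉ ∘ there)
      ... | inj₁ long | _         = inj₁ long
      ... | inj₂ _    | inj₁ long = inj₁ long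
      ... | inj₂ c    | inj₂ cs   = inj₂ (c ∷ cs)

      -- The first clause keeps `v` outside the set of deleted hits, so that a path from `x` to `v`
      -- avoiding them can be asked for again; the other two make `v` and `x` fit to join the
      -- successors.
      Admissible : Hit → Set
      Admissible h = v ≢ t h × ¬ (v ~ t⁺ h) × ¬ (x ~ t⁺ h)

      -- Each way of failing to be an admissible hit lengthens `P`: the ends of `P` by attaching the
      -- link there, an adjacency of `v` or `x` to the successor by `rotate` or `insert`.
      admit : ∀ {u} → u ∈ P → Link u → Longer ⊎ ∃ λ h → t h ≡ u × Admissible h
      admit {u} u∈P lk with u Fin.≟ v
      ... | yes refl = inj₁ (prepend lk)
      ... | no u≢v with locate walkP u∈P
      ...   | inj₁ refl = inj₁ (append lk)
      ...   | inj₂ (pre , post , u⁺ , P≡ , walk₁ , u~u⁺ , walk₂) with v ~? u⁺ | x ~? u⁺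
      ...     | yes v~u⁺ | _        = inj₁ (Hit.rotate (hit pre post P≡ walk₁ u~u⁺ walk₂ lk) v~u⁺)
      ...     | no _     | yes x~u⁺ = inj₁ (Hit.insert (hit pre post P≡ walk₁ u~u⁺ walk₂ lk) x~u⁺)
      ...     | no ¬v~u⁺ | no ¬x~u⁺ =
        inj₂ (hit pre post P≡ walk₁ u~u⁺ walk₂ lk , refl , u≢v ∘ sym , ¬v~u⁺ , ¬x~u⁺)

      -- The first vertex of P on a path from x to v that avoids all earlier hits is a new hit.
      collect : ∀ {k} → Connected G k → ∀ j → j ≤ k →
        Longer ⊎ ∃ λ hs → length hs ≡ j × AllPairs Compatible hs × All Admissible hs
      collect conn zero    _   = inj₂ ([] , refl , [] , [])
      collect conn (suc j) j<k with collect conn j (ℕ.<⇒≤ j<k)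
      ... | inj₁ long = inj₁ long
      ... | inj₂ (hs , refl , compatible , admissible)
        with proj₂ conn (toSubset (map t hs))
               (ℕ.≤-<-trans (∣toSubset∣≤length (map t hs)) (subst (_< _) (sym (List.length-map t hs)) j<k))
               (x∉ ∘ ∈-toSubset⁻ _) (v∉ ∘ ∈-toSubset⁻ _)
        where
        x∉ : x ∉ map t hs
        x∉ x∈ with ∈.∈-map⁻ t x∈
        ... | h , _ , refl = x∉P (Hit.t∈P h)
        v∉ : v ∉ map t hs
        v∉ v∈ with ∈.∈-map⁻ t v∈
        ... | h , h∈ , v≡t = proj₁ (All.lookup admissible h∈) v≡t
      ...   | l , (linked , _) , hd , lst , avoids with first-hit P (Linked⇒Walk linked hd lst) x∉P (start∈ walkP)
      ...     | R , y , u , walkR , y~u , u∈P , u∈l , R∉P with loop-erase walkR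
      ...       | Q , walkQ , uniqueQ , Q⊆R
        with admit u∈P (link walkQ y~u uniqueQ (All.tabulate (λ q∈ → All.lookup R∉P (Q⊆R q∈))))
      ...         | inj₁ long = inj₁ long
      ...         | inj₂ (h , refl , adm)
        with compareAll h hs (λ t∈ → All.lookup avoids u∈l (∈-toSubset⁺ t∈))
      ...           | inj₁ long = inj₁ long
      ...           | inj₂ comp = inj₂ (h ∷ hs , refl , comp ∷ compatible , adm ∷ admissible)

      improve : ∀ {k} → Connected G k → Longer ⊎ ∃ λ I → length I ≡ 2 + k × Independent I
      improve {k} conn with x ~? v
      ... | yes x~v = inj₁ (prepend (link stop x~v ([] ∷ []) (x∉P ∷ [])))
      ... | no ¬x~v with collect conn k ℕ.≤-refl
      ...   | inj₁ long = inj₁ long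
      ...   | inj₂ (hs , refl , compatible , admissible) = inj₂ (x ∷ v ∷ map t⁺ hs ,
        cong (2 +_) (List.length-map t⁺ hs) ,
        (((λ { refl → x∉P (start∈ walkP) }) , ¬x~v) ∷ All.map⁺ (All.map (λ {h} (_ , _ , ¬x~t⁺) →
          (λ { refl → x∉P (Hit.t⁺∈P h) }) , ¬x~t⁺) admissible))
        ∷ (All.map⁺ (All.map (λ {h} (_ , ¬v~t⁺ , _) → Hit.v≢t⁺ h , ¬v~t⁺) admissible)
        ∷ AllPairs.map⁺ compatible))

    chvátal-erdős : ∀ {k} → Connected G k → Traceable G ⊎ ∃ λ I → length I ≡ 2 + k × Independent I
    chvátal-erdős {k} conn = grow n (stop {Fin.fromℕ< (ℕ.≤-<-trans z≤n (proj₁ conn))}) ([] ∷ []) (ℕ.n<1+n n)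
      where
      -- The path length plus the fuel stays above `n`, whereas a list without repetition has at
      -- most `n` entries; so the path covers all vertices or an independent set appears before the
      -- fuel runs out.
      grow : ∀ fuel {v P w} → Walk v P w → Unique P → n < length P + fuel →
        Traceable G ⊎ ∃ λ I → length I ≡ 2 + k × Independent I
      grow zero {P = P} walkP uniqueP n<
        = contradiction (length-unique≤ uniqueP) (ℕ.<⇒≱ (subst (n <_) (ℕ.+-identityʳ (length P)) n<))
      grow (suc fuel) {P = P} walkP uniqueP n< with Fin.all? (_∈? P)
      ... | yes all∈P = inj₁ (P , (gapless⇒Linked walkP , uniqueP) , all∈P)
      ... | no ¬all∈P with Fin.¬∀⟶∃¬ n _ (_∈? P) ¬all∈P
      ...   | x , x∉P with FromPath.improve walkP uniqueP x∉P conn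
      ...     | inj₂ I = inj₂ I
      ...     | inj₁ (_ , P′ , _ , walkP′ , uniqueP′ , P<P′) = grow fuel walkP′ uniqueP′
        (ℕ.<-≤-trans n< (ℕ.≤-trans (ℕ.≤-reflexive (ℕ.+-suc (length P) fuel)) (ℕ.+-monoˡ-≤ fuel P<P′)))

  -- Nearly complete balanced bipartite graphs (Moon-Moser)

  filter-sides-↭ : ∀ {a} {A : Set a} (f : A → Bool) xs →
    filter (λ x → f x Bool.≟ true) xs ++ filter (λ x → f x Bool.≟ false) xs ↭ xs
  filter-sides-↭ f [] = ↭-refl
  filter-sides-↭ f (x ∷ xs) with f x
  ... | true  = prep x (filter-sides-↭ f xs)
  ... | false = ↭-trans (↭.shift x (filter (λ x → f x Bool.≟ true) xs) _) (prep x (filter-sides-↭ f xs))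

  module MoonMoser {n : ℕ} (G : Graph n) (side : Fin n → Bool) where
    open Graph G

    _∥_ : Fin n → Fin n → Set
    u ∥ v = side u ≢ side v

    open Arrangements G _∥_ (λ u∥v → u∥v ∘ sym)

    NonNeighbour : Fin n → Fin n → Set
    NonNeighbour u w = side u ≢ side w × ¬ (u ~ w)

    nonNeighbour? : ∀ u w → Dec (NonNeighbour u w)
    nonNeighbour? u w = ¬? (side u Bool.≟ side w) ×-dec ¬? (u ~? w)

    count : Bool → List (Fin n) → ℕ
    count b = sumOver (λ w → 𝟙 (side w Bool.≟ b))

    countNon : Fin n → List (Fin n) → ℕ
    countNon u = sumOver (λ w → 𝟙 (nonNeighbour? u w))

    private variable
      a b c p q u v : Fin n
      l : List (Fin n)
      g : ℕ

    -- The gap counts satisfy only an inequality, since the deleted step from `p` to `q` may itself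
    -- be a gap.
    split-at : ∀ W {Z} → Arrangement a (W ++ p ∷ q ∷ Z) c g →
      ∃₂ λ g₁ g₂ → Arrangement a (W ++ p ∷ []) p g₁ × Arrangement q (q ∷ Z) c g₂ × g₁ + g₂ ≤ g
    split-at [] (edge e w) with start-head w
    ... | refl = 0 , _ , stop , w , ℕ.≤-refl
    split-at [] (gap e w) with start-head w
    ... | refl = 0 , _ , stop , w , ℕ.n≤1+n _
    split-at (_ ∷ []) (edge e w) with split-at [] w
    ... | g₁ , g₂ , w₁ , w₂ , ≤g = g₁ , g₂ , edge e w₁ , w₂ , ≤g
    split-at (_ ∷ []) (gap e w) with split-at [] w
    ... | g₁ , g₂ , w₁ , w₂ , ≤g = suc g₁ , g₂ , gap e w₁ , w₂ , s≤s ≤g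
    split-at (_ ∷ W@(_ ∷ _)) (edge e w) with split-at W w
    ... | g₁ , g₂ , w₁ , w₂ , ≤g = g₁ , g₂ , edge e w₁ , w₂ , ≤g
    split-at (_ ∷ W@(_ ∷ _)) (gap e w) with split-at W w
    ... | g₁ , g₂ , w₁ , w₂ , ≤g = suc g₁ , g₂ , gap e w₁ , w₂ , s≤s ≤g

    split-gap : Arrangement a l c (suc g) → ∃₂ λ l₁ l₂ → ∃₂ λ p q → ∃₂ λ g₁ g₂ →
      l ≡ l₁ ++ l₂ × Arrangement a l₁ p g₁ × p ∥ q × Arrangement q l₂ c g₂ × g₁ + g₂ ≡ g
    split-gap (gap e w) = _ , _ , _ , _ , _ , _ , refl , stop , e , w , refl
    split-gap (edge e w) with split-gap w
    ... | l₁ , l₂ , p , q , g₁ , g₂ , refl , w₁ , p∥q , w₂ , refl =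
      _ , l₂ , p , q , g₁ , g₂ , refl , edge e w₁ , p∥q , w₂ , refl

    module _ (bipartite : ∀ {u v} → u ~ v → u ∥ v) where

      alternating : Arrangement a l b g → Linked _∥_ l
      alternating stop = [-]
      alternating (edge e stop)         = bipartite e ∷ [-]
      alternating (edge e w@(edge _ _)) = bipartite e ∷ alternating w
      alternating (edge e w@(gap _ _))  = bipartite e ∷ alternating w
      alternating (gap e stop)         = e ∷ [-]
      alternating (gap e w@(edge _ _)) = e ∷ alternating w
      alternating (gap e w@(gap _ _))  = e ∷ alternating w

    last-end : Arrangement a l b g → last l ≡ just b
    last-end stop = refl
    last-end (edge e stop)         = refl
    last-end (edge e w@(edge _ _)) = last-end w
    last-end (edge e w@(gap _ _))  = last-end w
    last-end (gap e stop)         = refl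
    last-end (gap e w@(edge _ _)) = last-end w
    last-end (gap e w@(gap _ _))  = last-end w

    -- The exchange pattern of Ore's theorem, with `v` the first and `u` the last vertex of `l`:
    -- from `v` to `p`, over to `u`, back to `q`, and from there to `v` again.
    Crossing : Fin n → Fin n → List (Fin n) → Set
    Crossing v u l = ∃₂ λ W p → ∃₂ λ q Z → l ≡ W ++ p ∷ q ∷ Z × p ~ u × q ~ v

    crossing-∷ : ∀ x → Crossing v u l → Crossing v u (x ∷ l)
    crossing-∷ x (W , p , q , Z , refl , p~u , q~v) = x ∷ W , p , q , Z , refl , p~u , q~v

    pair-bound : v ∥ u → a ∥ b → side a ≡ side v → ¬ (a ~ u × b ~ v) →
      count (side v) l ≤ countNon u l + countNon v l →
      count (side v) (a ∷ b ∷ l) ≤ countNon u (a ∷ b ∷ l) + countNon v (a ∷ b ∷ l)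
    pair-bound {v} {u} {a} {b} {l} v∥u a∥b a≡v ¬cross ≤l = begin
      𝟙 (side a Bool.≟ side v) + (𝟙 (side b Bool.≟ side v) + count (side v) l)
        ≡⟨ cong₂ (λ i j → i + (j + count (side v) l))
             (𝟙-yes (side a Bool.≟ side v) a≡v) (𝟙-no (side b Bool.≟ side v) (λ b≡v → a∥b (trans a≡v (sym b≡v)))) ⟩
      1 + count (side v) l
        ≤⟨ ℕ.+-mono-≤ one≤ ≤l ⟩
      (𝟙 (nonNeighbour? u a) + 𝟙 (nonNeighbour? v b)) + (countNon u l + countNon v l)
        ≤⟨ ℕ.m≤m+n _ (𝟙 (nonNeighbour? u b) + 𝟙 (nonNeighbour? v a)) ⟩
      (𝟙 (nonNeighbour? u a) + 𝟙 (nonNeighbour? v b)) + (countNon u l + countNon v l)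
        + (𝟙 (nonNeighbour? u b) + 𝟙 (nonNeighbour? v a))
        ≡⟨ solve 6 (λ ua vb nu nv ub va → ua :+ vb :+ (nu :+ nv) :+ (ub :+ va) := (ua :+ (ub :+ nu)) :+ (va :+ (vb :+ nv)))
             refl (𝟙 (nonNeighbour? u a)) (𝟙 (nonNeighbour? v b)) (countNon u l) (countNon v l)
             (𝟙 (nonNeighbour? u b)) (𝟙 (nonNeighbour? v a)) ⟩
      countNon u (a ∷ b ∷ l) + countNon v (a ∷ b ∷ l) ∎
      where
      open ℕ.≤-Reasoning
      open Data.Nat.Solver.+-*-Solver
      one≤ : 1 ≤ 𝟙 (nonNeighbour? u a) + 𝟙 (nonNeighbour? v b)
      one≤ with a ~? u
      ... | no ¬a~u = ℕ.≤-trans (ℕ.≤-reflexive (sym (𝟙-yes (nonNeighbour? u a)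
        ((λ u≡a → v∥u (sym (trans u≡a a≡v))) , ¬a~u ∘ ~-sym)))) (ℕ.m≤m+n _ _)
      ... | yes a~u = ℕ.≤-trans (ℕ.≤-reflexive (sym (𝟙-yes (nonNeighbour? v b)
        ((λ v≡b → a∥b (trans a≡v v≡b)) , λ v~b → ¬cross (a~u , ~-sym v~b))))) (ℕ.m≤n+m _ _)

    -- If no consecutive pair (p , q) with p on the side of v crosses, then each such p
    -- is a non-neighbour of u or its successor q is a non-neighbour of v.
    search : v ∥ u → ∀ l → Linked _∥_ l → last l ≡ just u →
      Crossing v u l ⊎ count (side v) l ≤ countNon u l + countNon v l
    -- The last vertex has no successor to charge, but it is `u`, which lies opposite to `v` and so
    -- is not counted.
    search {v} {u} v∥u (a ∷ []) [-] refl = inj₂ (ℕ.≤-trans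
      (ℕ.≤-reflexive (trans (ℕ.+-identityʳ _) (𝟙-no (side a Bool.≟ side v) (v∥u ∘ sym)))) z≤n)
    search {v} {u} v∥u (a ∷ b ∷ l) (a∥b ∷ lk) lst = by-cases (side a Bool.≟ side v) ((a ~? u) ×-dec (b ~? v)) l lk lst
      where
      by-cases : Dec (side a ≡ side v) → Dec (a ~ u × b ~ v) → ∀ l → Linked _∥_ (b ∷ l) → last (b ∷ l) ≡ just u →
        Crossing v u (a ∷ b ∷ l) ⊎ count (side v) (a ∷ b ∷ l) ≤ countNon u (a ∷ b ∷ l) + countNon v (a ∷ b ∷ l)
      by-cases _ (yes (a~u , b~v)) l _ _ = inj₁ ([] , a , b , l , refl , a~u , b~v)
      by-cases (no a≢v) (no _) l lk lst with search v∥u (b ∷ l) lk lst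
      ... | inj₁ cross = inj₁ (crossing-∷ a cross)
      ... | inj₂ ≤bl   = inj₂ (ℕ.≤-trans
        (ℕ.≤-reflexive (cong (_+ count (side v) (b ∷ l)) (𝟙-no (side a Bool.≟ side v) a≢v)))
        (ℕ.≤-trans ≤bl (ℕ.+-mono-≤ (ℕ.m≤n+m _ (𝟙 (nonNeighbour? u a))) (ℕ.m≤n+m _ (𝟙 (nonNeighbour? v a))))))
      by-cases (yes a≡v) (no ¬cross) [] _ _ = inj₂ (pair-bound {l = []} v∥u a∥b a≡v ¬cross z≤n)
      by-cases (yes a≡v) (no ¬cross) (c ∷ xs) (_ ∷ lk) lst with search v∥u (c ∷ xs) lk lst
      ... | inj₁ cross = inj₁ (crossing-∷ a (crossing-∷ b cross))
      ... | inj₂ ≤l    = inj₂ (pair-bound {l = c ∷ xs} v∥u a∥b a≡v ¬cross ≤l)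

    -- Every step is entered as a gap, with no adjacency examined; the descent on the number of gaps
    -- accepts any starting value.
    weave : ∀ a as b bs → length as ≡ length bs →
      All (λ u → side u ≡ true) (a ∷ as) → All (λ u → side u ≡ false) (b ∷ bs) →
      ∃₂ λ l c → ∃ λ g → Arrangement a l c g × side c ≡ false × l ↭ (a ∷ as) ++ (b ∷ bs)
    weave a [] b [] _ (a≡ ∷ []) (b≡ ∷ []) =
      a ∷ b ∷ [] , b , 1 , gap (λ a≡b → case trans (sym a≡) (trans a≡b b≡) of λ ()) stop , b≡ , ↭-refl
    weave a (a′ ∷ as) b (b′ ∷ bs) eq (a≡ ∷ a′≡ ∷ as≡) (b≡ ∷ bs≡) with weave a′ as b′ bs (ℕ.suc-injective eq) (a′≡ ∷ as≡) bs≡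
    ... | l , c , g , w , c≡ , l↭ = a ∷ b ∷ l , c , _ ,
      gap (λ a≡b → case trans (sym a≡) (trans a≡b b≡) of λ ()) (gap (λ b≡a → case trans (sym a′≡) (trans (sym b≡a) b≡) of λ ()) w) ,
      c≡ , prep a (↭-trans (prep b l↭) (↭-sym (↭.shift b (a′ ∷ as) (b′ ∷ bs))))

    module _ (bipartite : ∀ {u v} → u ~ v → u ∥ v) {s : ℕ} (5≤s : 5 ≤ s)
      (balanced : ∀ b → sum (λ u → 𝟙 (side u Bool.≟ b)) ≡ s)
      (few : ∀ u → sum (λ w → 𝟙 (nonNeighbour? u w)) ≤ 2) where

      -- Without a crossing, the `s` vertices on the side of `v` would be paid for by non-neighbours
      -- of `u` and of `v`, of which there are at most 2 + 2; this is where `5 ≤ s` is spent.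
      crossing : Arrangement v l u g → v ∥ u → l ↭ allFin n → Crossing v u l
      crossing {v} {l} {u} w v∥u l↭ with search v∥u l (alternating bipartite w) (last-end w)
      ... | inj₁ cross = cross
      ... | inj₂ ≤l    = contradiction 5≤s (ℕ.<⇒≱ (s≤s (begin
        s                                 ≡⟨ balanced (side v) ⟨
        sum (λ w → 𝟙 (side w Bool.≟ side v))  ≡⟨ total _ ⟨
        count (side v) l                  ≤⟨ ≤l ⟩
        countNon u l + countNon v l       ≡⟨ cong₂ _+_ (total _) (total _) ⟩
        sum (λ w → 𝟙 (nonNeighbour? u w)) + sum (λ w → 𝟙 (nonNeighbour? v w)) ≤⟨ ℕ.+-mono-≤ (few u) (few v) ⟩
        4                                 ∎)))
        where
        open ℕ.≤-Reasoning
        total : ∀ f → sumOver f l ≡ sum f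
        total f = trans (sumOver-↭ f l↭) (sumOver-tabulate f id)

      -- Reversing the part of a crossing arrangement after p makes it a closed one.
      close : Arrangement v l u g → v ∥ u → l ↭ allFin n →
        ∃₂ λ l′ u′ → ∃ λ g′ → Arrangement v l′ u′ g′ × u′ ~ v × l′ ↭ allFin n × g′ ≤ g
      close {v} {l} {u} {g} w v∥u l↭ with crossing w v∥u l↭
      ... | W , p , q , Z , refl , p~u , q~v with split-at W w
      ...   | g₁ , g₂ , w₁ , w₂ , ≤g = _ , q , _ , join w₁ p~u (reversed w₂) , q~v ,
        ↭-trans (↭.++⁺ˡ (W ++ p ∷ []) (↭.↭-reverse (q ∷ Z)))
          (↭-trans (↭-reflexive (List.++-assoc W (p ∷ []) (q ∷ Z))) l↭) , ≤g

      traceable : Arrangement v l u 0 → l ↭ allFin n → Traceable G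
      traceable {l = l} w l↭ = l , (gapless⇒Linked w , Unique-resp-↭ (↭-sym l↭) (Unique.allFin⁺ n)) ,
        λ v → ↭.∈-resp-↭ (↭-sym l↭) (∈.∈-allFin v)

      -- Closing an arrangement costs no gap, and cutting the closed arrangement at a gap removes that gap.
      reduce : ∀ fuel → g ≤ fuel → Arrangement v l u g → v ∥ u → l ↭ allFin n → Traceable G
      reduce {zero} fuel _ w _ l↭ = traceable w l↭
      reduce {suc g} (suc fuel) (s≤s g≤) w v∥u l↭ with close w v∥u l↭
      ... | l′ , u′ , zero , w′ , u′~v , l′↭ , _ = traceable w′ l′↭
      ... | l′ , u′ , suc g′ , w′ , u′~v , l′↭ , s≤s g′≤g with split-gap w′
      ...   | l₁ , l₂ , p , q , g₁ , g₂ , refl , w₁ , p∥q , w₂ , refl =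
        reduce fuel (ℕ.≤-trans (ℕ.≤-reflexive (ℕ.+-comm g₂ g₁)) (ℕ.≤-trans g′≤g g≤))
          (join w₂ u′~v w₁) (p∥q ∘ sym) (↭-trans (↭.++-comm l₂ l₁) l′↭)

      moon-moser : Traceable G
      moon-moser = start (class true) (class false) (size true) (size false) (all-side true) (all-side false)
                     (filter-sides-↭ side (allFin n))
        where
        class : Bool → List (Fin n)
        class b = filter (λ u → side u Bool.≟ b) (allFin n)
        size : ∀ b → length (class b) ≡ s
        size b = trans (length-filter-allFin (λ u → side u Bool.≟ b)) (balanced b)
        all-side : ∀ b → All (λ u → side u ≡ b) (class b)
        all-side b = All.all-filter (λ u → side u Bool.≟ b) (allFin n)
        start : ∀ as bs → length as ≡ s → length bs ≡ s →
          All (λ u → side u ≡ true) as → All (λ u → side u ≡ false) bs → as ++ bs ↭ allFin n → Traceable G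
        start []       _        refl _    = contradiction 5≤s λ ()
        start (_ ∷ _)  []       _    refl = contradiction 5≤s λ ()
        start (a ∷ as) (b ∷ bs) refl eq as≡ bs≡ perm with weave a as b bs (sym (ℕ.suc-injective eq)) as≡ bs≡
        ... | l , c , g , w , c≡ , l↭ =
          reduce g ℕ.≤-refl w (λ a≡c → case trans (sym (All.head as≡)) (trans a≡c c≡) of λ ()) (↭-trans l↭ perm)

  -- Degree sums and the minimum degree

  module Degrees {n : ℕ} (G : Graph n) where
    open Graph G
    open import Data.List.Membership.DecPropositional (Fin._≟_ {n}) using (_∈?_)

    private
      d : Fin n → ℕ
      d = degree G

    adj : Fin n → Fin n → ℕ
    adj u v = 𝟙 (u ~? v)

    adj-sym : ∀ u v → adj u v ≡ adj v u
    adj-sym u v = 𝟙-cong (u ~? v) (v ~? u) ~-sym ~-sym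

    degree-sum : ∀ u → d u ≡ sum (adj u)
    degree-sum u = length-filter-allFin (u ~?_)

    handshake : sum d ≡ edgeCount G + edgeCount G
    handshake = begin
      sum d                                                  ≡⟨ sum-cong-≗ degree-sum ⟩
      sum (λ u → sum (λ v → adj u v))                        ≡⟨ sum-cong-≗ (λ u → sum-cong-≗ (oriented u)) ⟩
      sum (λ u → sum (λ v → E u v + E v u))                  ≡⟨ sum-cong-≗ (λ u → ∑-distrib-+ (E u) (λ v → E v u)) ⟩
      sum (λ u → sum (E u) + sum (λ v → E v u))              ≡⟨ ∑-distrib-+ (sum ∘ E) (λ u → sum (λ v → E v u)) ⟩
      sum (sum ∘ E) + sum (λ u → sum (λ v → E v u))          ≡⟨ cong (sum (sum ∘ E) +_) (∑-comm (λ u v → E v u)) ⟩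
      sum (sum ∘ E) + sum (sum ∘ E)                          ≡⟨ cong₂ _+_ count count ⟨
      edgeCount G + edgeCount G                              ∎
      where
      open ≡-Reasoning
      E? : ∀ u v → Dec (u Fin.< v × u ~ v)
      E? u v = (u Fin.<? v) ×-dec (u ~? v)
      E : Fin n → Fin n → ℕ
      E u v = 𝟙 (E? u v)
      oriented : ∀ u v → adj u v ≡ E u v + E v u
      oriented u v with Fin.<-cmp u v
      ... | tri< u<v _ v≮u = trans (𝟙-cong (u ~? v) (E? u v) (u<v ,_) proj₂)
        (sym (trans (cong (E u v +_) (𝟙-no (E? v u) (v≮u ∘ proj₁))) (ℕ.+-identityʳ _)))
      ... | tri> u≮v _ v<u = trans (𝟙-cong (u ~? v) (E? v u) ((v<u ,_) ∘ ~-sym) (~-sym ∘ proj₂))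
        (sym (cong (_+ E v u) (𝟙-no (E? u v) (u≮v ∘ proj₁))))
      ... | tri≈ u≮v refl _ = trans (𝟙-no (u ~? u) ~-irrefl)
        (sym (cong₂ _+_ (𝟙-no (E? u u) (u≮v ∘ proj₁)) (𝟙-no (E? u u) (u≮v ∘ proj₁))))
      count : edgeCount G ≡ sum (sum ∘ E)
      count = trans (length-filter (λ (u , v) → E? u v) (cartesianProduct (allFin n) (allFin n)))
        (trans (sumOver-cartesianProduct (λ (u , v) → E u v) (allFin n) (allFin n))
        (trans (sumOver-tabulate (λ u → sumOver (E u) (allFin n)) id)
          (sum-cong-≗ (λ u → sumOver-tabulate (E u) id))))

    minDegree≤ : ∀ u → minDegree G ≤ d u
    minDegree≤ u = All.lookup (Extrema.min≤xs n (map d (allFin n))) (∈.∈-map⁺ d (∈.∈-allFin u))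

    ≤maxDegree : ∀ u → d u ≤ maxDegree G
    ≤maxDegree u = All.lookup (Extrema.xs≤max 0 (map d (allFin n))) (∈.∈-map⁺ d (∈.∈-allFin u))

    cube : ∀ m → m * m * m ≡ m ^ 3
    cube = solve 1 (λ m → m :* m :* m := m :* (m :* (m :* con 1))) refl
      where open Data.Nat.Solver.+-*-Solver

    sum-δ³ : sum {n} (λ _ → minDegree G ^ 3) ≡ n * (minDegree G * minDegree G * minDegree G)
    sum-δ³ = trans (sum-const n (minDegree G ^ 3)) (cong (n *_) (sym (cube (minDegree G))))

    δ³≤d³ : ∀ u → minDegree G ^ 3 ≤ d u ^ 3
    δ³≤d³ u = ℕ.^-monoˡ-≤ 3 (minDegree≤ u)

    n*δ³≤forgotten : n * (minDegree G * minDegree G * minDegree G) ≤ forgotten G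
    n*δ³≤forgotten = ℕ.≤-trans (ℕ.≤-reflexive (sym sum-δ³)) (sum-mono _ _ δ³≤d³)

    -- The two alternatives are the forms in which the conditions deliver regularity: those on Z₁
    -- and Inv close the gap between Δ and δ, those on F leave no slack in n δ³ ≤ F.
    tight⇒regular : maxDegree G ≤ minDegree G ⊎ forgotten G ≤ n * (minDegree G * minDegree G * minDegree G) →
      ∀ u → d u ≡ minDegree G
    tight⇒regular (inj₁ Δ≤δ)   u = ℕ.≤-antisym (ℕ.≤-trans (≤maxDegree u) Δ≤δ) (minDegree≤ u)
    tight⇒regular (inj₂ F≤nδ³) u = ℕ.≤-antisym
      (ℕ.≮⇒≥ λ δ<d → ℕ.<⇒≢ (ℕ.^-monoˡ-< 3 δ<d)
        (sum-tight _ _ δ³≤d³ (ℕ.≤-trans F≤nδ³ (ℕ.≤-reflexive (sym sum-δ³))) u))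
      (minDegree≤ u)

    -- Deleting the neighbourhood of u would isolate u.
    connected⇒≤degree : ∀ {k} → Connected G k → ∀ u → k ≤ d u
    connected⇒≤degree {k} (k<n , conn) u with k ℕ.≤? d u
    ... | yes k≤d = k≤d
    ... | no k≰d = contradiction-path
      (conn (toSubset N) (ℕ.≤-<-trans (∣toSubset∣≤length N) d<k)
        (u∉N ∘ ∈-toSubset⁻ N) (λ v∈ → v∉ (there (∈-toSubset⁻ N v∈))))
      where
      N : List (Fin n)
      N = filter (u ~?_) (allFin n)
      d<k : d u < k
      d<k = ℕ.≰⇒> k≰d
      u∉N : u ∉ N
      u∉N u∈ = ~-irrefl (proj₂ (∈.∈-filter⁻ (u ~?_) {xs = allFin n} u∈))
      missed : ∃ λ v → v ∉ u ∷ N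
      -- The vertex `u` and its neighbours are at most k in number, and k < n, so some vertex is
      -- left to be cut off from `u`.
      missed = Fin.¬∀⟶∃¬ n _ (_∈? (u ∷ N)) (λ all → ℕ.<⇒≱ (ℕ.≤-<-trans d<k k<n) (length-cover≥ (u ∷ N) all))
      v : Fin n
      v = proj₁ missed
      v∉ : v ∉ u ∷ N
      v∉ = proj₂ missed
      contradiction-path : PathAvoiding G (toSubset N) u v → k ≤ d u
      contradiction-path (_ , ([-] , _) , refl , eq , _) = contradiction (here (sym (just-injective eq))) v∉
      contradiction-path (_ , (_∷_ {y = y} u~y _ , _) , refl , _ , _ ∷ y∉ ∷ _) =
        contradiction (∈-toSubset⁺ (∈.∈-filter⁺ (u ~?_) (∈.∈-allFin y) u~y)) y∉

    connected⇒≤minDegree : ∀ {k} → Connected G k → k ≤ minDegree G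
    connected⇒≤minDegree conn = Extrema.v≤min⁺ {xs = map d (allFin n)} (ℕ.<⇒≤ (proj₁ conn))
      (All.map⁺ (All.tabulate (λ {u} _ → connected⇒≤degree conn u)))

    -- Estimates from an independent set

    module IndependentSet (I : List (Fin n)) (independent : ChvátalErdős.Independent G I) where

      s : ℕ
      s = length I

      χ : Fin n → ℕ
      χ u = 𝟙 (u ∈? I)

      degreeSum : ℕ
      degreeSum = sum (λ u → χ u * d u)

      sum-χ : sum χ ≡ s
      sum-χ = sum-∈ (AllPairs.map proj₁ independent)

      sum-χ* : ∀ c → sum (λ u → χ u * c) ≡ s * c
      sum-χ* c = trans (sym (*-distribʳ-sum c χ)) (cong (_* c) sum-χ)

      nonadjacent : ∀ {u v} → u ∈ I → v ∈ I → ¬ (u ~ v)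
      nonadjacent = go independent
        where
        go : ∀ {xs u v} → ChvátalErdős.Independent G xs → u ∈ xs → v ∈ xs → ¬ (u ~ v)
        go _        (here refl) (here refl) = ~-irrefl
        go (i ∷ _)  (here refl) (there v∈)  = proj₂ (All.lookup i v∈)
        go (i ∷ _)  (there u∈)  (here refl) = proj₂ (All.lookup i u∈) ∘ ~-sym
        go (_ ∷ is) (there u∈)  (there v∈)  = go is u∈ v∈

      -- For an adjacent pair this is the number of its ends in `I`, which independence keeps at
      -- most 1; slack in `covered≤adj` marks the edges that miss `I`.
      covered : Fin n → Fin n → ℕ
      covered u v = χ u * adj u v + χ v * adj u v

      covered≤adj : ∀ u v → covered u v ≤ adj u v
      covered≤adj u v with u ∈? I | v ∈? I | u ~? v
      ... | yes u∈ | yes v∈ | yes u~v = contradiction u~v (nonadjacent u∈ v∈)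
      ... | yes _  | yes _  | no _    = z≤n
      ... | yes _  | no _   | yes _   = ℕ.≤-refl
      ... | yes _  | no _   | no _    = z≤n
      ... | no _   | yes _  | yes _   = ℕ.≤-refl
      ... | no _   | yes _  | no _    = z≤n
      ... | no _   | no _   | _       = z≤n

      sum-covered : sum (sum ∘ covered) ≡ degreeSum + degreeSum
      sum-covered = begin
        sum (λ u → sum (λ v → χ u * adj u v + χ v * adj u v))
          ≡⟨ sum-cong-≗ (λ u → ∑-distrib-+ (λ v → χ u * adj u v) (λ v → χ v * adj u v)) ⟩
        sum (λ u → sum (λ v → χ u * adj u v) + sum (λ v → χ v * adj u v))
          ≡⟨ ∑-distrib-+ (λ u → sum (λ v → χ u * adj u v)) (λ u → sum (λ v → χ v * adj u v)) ⟩
        sum (λ u → sum (λ v → χ u * adj u v)) + sum (λ u → sum (λ v → χ v * adj u v))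
          ≡⟨ cong₂ _+_ outgoing (trans (∑-comm (λ u v → χ v * adj u v))
               (trans (sum-cong-≗ (λ v → sum-cong-≗ (λ u → cong (χ v *_) (adj-sym u v)))) outgoing)) ⟩
        degreeSum + degreeSum ∎
        where
        open ≡-Reasoning
        outgoing : sum (λ u → sum (λ v → χ u * adj u v)) ≡ degreeSum
        outgoing = sum-cong-≗ (λ u → trans (sym (*-distribˡ-sum (χ u) (adj u))) (cong (χ u *_) (sym (degree-sum u))))

      sum-adj : sum (sum ∘ adj) ≡ edgeCount G + edgeCount G
      sum-adj = trans (sym (sum-cong-≗ degree-sum)) handshake

      -- The comparison is made between doubles, because a sum over ordered pairs meets each edge
      -- twice.
      degreeSum≤e : degreeSum ≤ edgeCount G
      degreeSum≤e = ℕ.≮⇒≥ λ e<A → ℕ.<⇒≱ (ℕ.+-mono-< e<A e<A) (begin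
        degreeSum + degreeSum         ≡⟨ sum-covered ⟨
        sum (sum ∘ covered)           ≤⟨ sum-mono _ _ (λ u → sum-mono _ _ (covered≤adj u)) ⟩
        sum (sum ∘ adj)               ≡⟨ sum-adj ⟩
        edgeCount G + edgeCount G     ∎)
        where open ℕ.≤-Reasoning

      s*δ≤degreeSum : s * minDegree G ≤ degreeSum
      s*δ≤degreeSum = ℕ.≤-trans (ℕ.≤-reflexive (sym (sum-χ* (minDegree G))))
        (sum-mono _ _ (λ u → ℕ.*-monoʳ-≤ (χ u) (minDegree≤ u)))

      s*δ≤e : s * minDegree G ≤ edgeCount G
      s*δ≤e = ℕ.≤-trans s*δ≤degreeSum degreeSum≤e

      -- (1 - χ) f ≤ (1 - χ) c, summed, with the subtractions moved across.
      sum-outside≤ : ∀ (f : Fin n → ℕ) c → (∀ u → f u ≤ c) → sum f + s * c ≤ n * c + sum (λ u → χ u * f u)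
      sum-outside≤ f c f≤c = begin
        sum f + s * c                           ≡⟨ cong (sum f +_) (sum-χ* c) ⟨
        sum f + sum (λ u → χ u * c)             ≡⟨ ∑-distrib-+ f (λ u → χ u * c) ⟨
        sum (λ u → f u + χ u * c)               ≤⟨ sum-mono _ _ pointwise ⟩
        sum (λ u → c + χ u * f u)               ≡⟨ ∑-distrib-+ (λ _ → c) (λ u → χ u * f u) ⟩
        sum {n} (λ _ → c) + sum (λ u → χ u * f u) ≡⟨ cong (_+ sum (λ u → χ u * f u)) (sum-const n c) ⟩
        n * c + sum (λ u → χ u * f u)           ∎
        where
        open ℕ.≤-Reasoning
        pointwise : ∀ u → f u + χ u * c ≤ c + χ u * f u
        pointwise u with u ∈? I
        ... | no _  = ℕ.+-monoˡ-≤ 0 (f≤c u)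
        ... | yes _ = ℕ.≤-reflexive (trans (ℕ.+-comm (f u) (1 * c))
          (cong₂ _+_ (ℕ.*-identityˡ c) (sym (ℕ.*-identityˡ (f u)))))

      module _ {r : ℕ} (n≡ : n ≡ s + r) where

        e≤r*Δ : edgeCount G ≤ r * maxDegree G
        -- Adding e completes the left side to the degree total e + e, and adding s Δ avoids the
        -- subtraction n - s; the vertices of `I` account for at most e of that total.
        e≤r*Δ = ℕ.+-cancelʳ-≤ (e + s * Δ) _ _ (begin
          e + (e + s * Δ)        ≡⟨ ℕ.+-assoc e e (s * Δ) ⟨
          e + e + s * Δ          ≡⟨ cong (_+ s * Δ) handshake ⟨
          sum d + s * Δ          ≤⟨ sum-outside≤ d Δ ≤maxDegree ⟩
          n * Δ + degreeSum      ≤⟨ ℕ.+-monoʳ-≤ (n * Δ) degreeSum≤e ⟩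
          n * Δ + e              ≡⟨ cong (λ n → n * Δ + e) n≡ ⟩
          (s + r) * Δ + e        ≡⟨ solve 4 (λ s r Δ e → (s :+ r) :* Δ :+ e := r :* Δ :+ (e :+ s :* Δ)) refl s r Δ e ⟩
          r * Δ + (e + s * Δ)    ∎)
          where
          open ℕ.≤-Reasoning
          open Data.Nat.Solver.+-*-Solver
          e Δ : ℕ
          e = edgeCount G
          Δ = maxDegree G

        -- A vertex outside `I` contributes at most Δ². Inside `I` only one factor of d² is raised
        -- to Δ, so that `degreeSum≤e` still applies to the other.
        firstZagreb≤ : firstZagreb G ≤ r * (maxDegree G * maxDegree G) + maxDegree G * edgeCount G
        firstZagreb≤ = ℕ.+-cancelʳ-≤ (s * (Δ * Δ)) _ _ (begin
          sum (λ u → d u ^ 2) + s * (Δ * Δ)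
            ≡⟨ cong (_+ s * (Δ * Δ)) (sum-cong-≗ square) ⟩
          sum (λ u → d u * d u) + s * (Δ * Δ)
            ≤⟨ sum-outside≤ (λ u → d u * d u) (Δ * Δ) (λ u → ℕ.*-mono-≤ (≤maxDegree u) (≤maxDegree u)) ⟩
          n * (Δ * Δ) + sum (λ u → χ u * (d u * d u))
            ≤⟨ ℕ.+-monoʳ-≤ (n * (Δ * Δ)) (sum-mono _ _ (λ u → ℕ.≤-trans
                 (ℕ.*-monoʳ-≤ (χ u) (ℕ.*-monoˡ-≤ (d u) (≤maxDegree u))) (ℕ.≤-reflexive (swap (χ u) Δ (d u))))) ⟩
          n * (Δ * Δ) + sum (λ u → Δ * (χ u * d u))
            ≡⟨ cong (n * (Δ * Δ) +_) (*-distribˡ-sum Δ (λ u → χ u * d u)) ⟨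
          n * (Δ * Δ) + Δ * degreeSum
            ≤⟨ ℕ.+-monoʳ-≤ (n * (Δ * Δ)) (ℕ.*-monoʳ-≤ Δ degreeSum≤e) ⟩
          n * (Δ * Δ) + Δ * e
            ≡⟨ cong (λ n → n * (Δ * Δ) + Δ * e) n≡ ⟩
          (s + r) * (Δ * Δ) + Δ * e
            ≡⟨ solve 4 (λ s r Δ e → (s :+ r) :* (Δ :* Δ) :+ Δ :* e := r :* (Δ :* Δ) :+ Δ :* e :+ s :* (Δ :* Δ)) refl s r Δ e ⟩
          r * (Δ * Δ) + Δ * e + s * (Δ * Δ) ∎)
          where
          open ℕ.≤-Reasoning
          open Data.Nat.Solver.+-*-Solver
          e Δ : ℕ
          e = edgeCount G
          Δ = maxDegree G
          square : ∀ u → d u ^ 2 ≡ d u * d u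
          square u = cong (d u *_) (ℕ.*-identityʳ (d u))
          swap : ∀ a b c → a * (b * c) ≡ b * (a * c)
          swap = solve 3 (λ a b c → a :* (b :* c) := b :* (a :* c)) refl

      -- The extremal graphs

      side : Fin n → Bool
      side u = does (u ∈? I)

      𝟙-side-true : ∀ u → 𝟙 (side u Bool.≟ true) ≡ χ u
      𝟙-side-true u with u ∈? I
      ... | yes _ = refl
      ... | no _  = refl

      𝟙-side-false : ∀ u → χ u + 𝟙 (side u Bool.≟ false) ≡ 1
      𝟙-side-false u with u ∈? I
      ... | yes _ = refl
      ... | no _  = refl

      module Extremal (k : ℕ) (s≡ : s ≡ 2 + k) (n≥9 : 9 ≤ n) (conn : Connected G k) (0<δ : 0 < minDegree G)
        (regular : ∀ u → d u ≡ minDegree G) (e≡ : edgeCount G ≡ s * minDegree G) where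

        δ : ℕ
        δ = minDegree G

        degreeSum≡e : degreeSum ≡ edgeCount G
        degreeSum≡e = trans (sum-cong-≗ (λ u → cong (χ u *_) (regular u))) (trans (sum-χ* δ) (sym e≡))

        n≡s+s : n ≡ s + s
        n≡s+s = ℕ.*-cancelʳ-≡ n (s + s) δ {{ℕ.>-nonZero 0<δ}} (begin
          n * δ             ≡⟨ sum-const n δ ⟨
          sum {n} (λ _ → δ) ≡⟨ sum-cong-≗ regular ⟨
          sum d             ≡⟨ handshake ⟩
          edgeCount G + edgeCount G ≡⟨ cong₂ _+_ e≡ e≡ ⟩
          s * δ + s * δ     ≡⟨ ℕ.*-distribʳ-+ δ s s ⟨
          (s + s) * δ       ∎)
          where open ≡-Reasoning

        -- From s ≤ 4 would follow n = s + s ≤ 8.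
        5≤s : 5 ≤ s
        5≤s = ℕ.≮⇒≥ λ { (s≤s s≤4) → ℕ.<⇒≱ (s≤s (ℕ.+-mono-≤ s≤4 s≤4)) (subst (9 ≤_) n≡s+s n≥9) }

        -- Tightness is used twice: equality of the grand totals descends to the row sums, and then
        -- to the entries of the row of `u`.
        all-covered : ∀ u v → covered u v ≡ adj u v
        all-covered u v = sum-tight (covered u) (adj u) (covered≤adj u)
          (ℕ.≤-reflexive (sym (sum-tight (sum ∘ covered) (sum ∘ adj) (λ u → sum-mono _ _ (covered≤adj u))
            (ℕ.≤-reflexive (trans sum-adj (trans (sym (cong₂ _+_ degreeSum≡e degreeSum≡e)) (sym sum-covered)))) u))) v

        bipartite : ∀ {u v} → u ~ v → side u ≢ side v
        bipartite {u} {v} u~v with all-covered u v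
        ... | eq with u ∈? I | v ∈? I | u ~? v
        ...   | yes _ | no _  | _     = λ ()
        ...   | no _  | yes _ | _     = λ ()
        ...   | yes u∈ | yes v∈ | _   = contradiction u~v (nonadjacent u∈ v∈)
        -- An edge with both ends outside `I` would be covered 0 times, yet it counts 1.
        ...   | no _  | no _  | yes _ = case eq of λ ()
        ...   | no _  | no _  | no ¬u~v = contradiction u~v ¬u~v

        balanced : ∀ b → sum (λ u → 𝟙 (side u Bool.≟ b)) ≡ s
        balanced true  = trans (sum-cong-≗ 𝟙-side-true) sum-χ
        balanced false = ℕ.+-cancelˡ-≡ s _ _ (begin
          s + sum (λ u → 𝟙 (side u Bool.≟ false))      ≡⟨ cong (_+ sum (λ u → 𝟙 (side u Bool.≟ false))) sum-χ ⟨
          sum χ + sum (λ u → 𝟙 (side u Bool.≟ false))  ≡⟨ ∑-distrib-+ χ (λ u → 𝟙 (side u Bool.≟ false)) ⟨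
          sum (λ u → χ u + 𝟙 (side u Bool.≟ false))    ≡⟨ sum-cong-≗ 𝟙-side-false ⟩
          sum {n} (λ _ → 1)                            ≡⟨ trans (sum-const n 1) (ℕ.*-identityʳ n) ⟩
          n                                            ≡⟨ n≡s+s ⟩
          s + s                                        ∎)
          where open ≡-Reasoning

        open MoonMoser G side using (NonNeighbour; nonNeighbour?; moon-moser)

        few : ∀ u → sum (λ w → 𝟙 (nonNeighbour? u w)) ≤ 2
        few u = ℕ.+-cancelʳ-≤ (d u) _ _ (begin
          sum (λ w → 𝟙 (nonNeighbour? u w)) + d u          ≡⟨ cong (sum (λ w → 𝟙 (nonNeighbour? u w)) +_) (degree-sum u) ⟩
          sum (λ w → 𝟙 (nonNeighbour? u w)) + sum (adj u)  ≡⟨ ∑-distrib-+ (λ w → 𝟙 (nonNeighbour? u w)) (adj u) ⟨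
          sum (λ w → 𝟙 (nonNeighbour? u w) + adj u w)      ≤⟨ sum-mono _ _ opposite ⟩
          sum (λ w → 𝟙 (side w Bool.≟ not (side u)))       ≡⟨ balanced (not (side u)) ⟩
          s                                                ≡⟨ s≡ ⟩
          2 + k                                            ≤⟨ ℕ.+-monoʳ-≤ 2 (connected⇒≤degree conn u) ⟩
          2 + d u                                          ∎)
          where
          open ℕ.≤-Reasoning
          by-cases : ∀ w (non? : Dec (NonNeighbour u w)) (u~?w : Dec (u ~ w)) →
            𝟙 non? + 𝟙 u~?w ≤ 𝟙 (side w Bool.≟ not (side u))
          by-cases w (yes (_ , ¬u~w)) (yes u~w) = contradiction u~w ¬u~w
          by-cases w (yes (u∥w , _))  (no _)    = ℕ.≤-reflexive (sym (𝟙-yes (side w Bool.≟ not (side u)) (Bool.¬-not (u∥w ∘ sym))))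
          by-cases w (no _)           (yes u~w) = ℕ.≤-reflexive (sym (𝟙-yes (side w Bool.≟ not (side u)) (Bool.¬-not (bipartite u~w ∘ sym))))
          by-cases w (no _)           (no _)    = z≤n
          opposite : ∀ w → 𝟙 (nonNeighbour? u w) + adj u w ≤ 𝟙 (side w Bool.≟ not (side u))
          opposite w = by-cases w (nonNeighbour? u w) (u ~? w)

        extremal-traceable : Traceable G
        extremal-traceable = moon-moser bipartite 5≤s balanced few

  -- Equality cases in the natural numbers

  module _ where
    open ℕ.≤-Reasoning
    open Data.Nat.Solver.+-*-Solver

    -- Here `t` is the distance of `x` and `y`: this is the expansion of (x - y)² without
    -- subtraction, kept with its equality case.
    square-gap : ∀ x y → ∃ λ t → x * x + y * y ≡ 2 * (x * y) + t * t × (t ≡ 0 → x ≡ y)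
    square-gap x y with ℕ.≤-total x y
    ... | inj₁ x≤y with ℕ.m≤n⇒∃[o]m+o≡n x≤y
    ...   | t , refl = t , solve 2 (λ x t → x :* x :+ (x :+ t) :* (x :+ t) := con 2 :* (x :* (x :+ t)) :+ t :* t) refl x t ,
      λ { refl → sym (ℕ.+-identityʳ x) }
    square-gap x y | inj₂ y≤x with ℕ.m≤n⇒∃[o]m+o≡n y≤x
    ...   | t , refl = t , solve 2 (λ y t → (y :+ t) :* (y :+ t) :+ y :* y := con 2 :* ((y :+ t) :* y) :+ t :* t) refl y t ,
      λ { refl → ℕ.+-identityʳ y }

    2xy≤x²+y² : ∀ x y → 2 * (x * y) ≤ x * x + y * y
    2xy≤x²+y² x y with square-gap x y
    ... | t , eq , _ = ℕ.≤-trans (ℕ.m≤m+n _ (t * t)) (ℕ.≤-reflexive (sym eq))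

    x²+y²≤2xy⇒x≡y : ∀ x y → x * x + y * y ≤ 2 * (x * y) → x ≡ y
    x²+y²≤2xy⇒x≡y x y ≤2xy with square-gap x y
    ... | t , eq , t≡0⇒ = t≡0⇒ (square≡0 t (ℕ.n≤0⇒n≡0 (ℕ.+-cancelˡ-≤ (2 * (x * y)) _ _ (begin
      2 * (x * y) + t * t ≡⟨ eq ⟨
      x * x + y * y       ≤⟨ ≤2xy ⟩
      2 * (x * y)         ≡⟨ ℕ.+-identityʳ _ ⟨
      2 * (x * y) + 0     ∎))))
      where
      square≡0 : ∀ t → t * t ≡ 0 → t ≡ 0
      square≡0 zero _ = refl

    square-cancel-≤ : ∀ x y → x * x ≤ y * y → x ≤ y
    square-cancel-≤ x y xx≤yy = ℕ.≮⇒≥ λ y<x → ℕ.<⇒≱ (ℕ.*-mono-< y<x y<x) xx≤yy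

    -- The last hypothesis is the condition on Z₁ multiplied by 2 s δ. With x = s Δ the upper bound
    -- on `Z` reduces it to δ e² + Δ x² ≤ 2 δ e x ≤ δ (e² + x²). Comparing the terms in x² gives Δ ≤
    -- δ, and equality of the means gives e = x.
    zagreb-tight : ∀ {e δ Δ Z s r} → 0 < δ → 0 < s → δ ≤ Δ → Z ≤ r * (Δ * Δ) + Δ * e →
      s * 2 * δ * (r * (Δ * Δ)) + δ * (e * e) + s * (s * (Δ * Δ * Δ)) ≤ s * 2 * δ * Z →
      Δ ≤ δ × e ≡ s * Δ
    zagreb-tight {e} {δ} {Δ} {Z} {s} {r} 0<δ 0<s δ≤Δ Z≤ hyp = Δ≤δ , x²+y²≤2xy⇒x≡y e x (ℕ.*-cancelˡ-≤ δ {{ℕ.>-nonZero 0<δ}} (begin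
      δ * (e * e + x * x)       ≡⟨ ℕ.*-distribˡ-+ δ (e * e) (x * x) ⟩
      δ * (e * e) + δ * (x * x) ≤⟨ ℕ.+-monoʳ-≤ (δ * (e * e)) (ℕ.*-monoˡ-≤ (x * x) δ≤Δ) ⟩
      δ * (e * e) + Δ * (x * x) ≤⟨ main ⟩
      δ * (2 * (e * x))         ∎))
      where
      x : ℕ
      x = s * Δ
      0<x : 0 < x * x
      0<x = ℕ.*-mono-< {0} {x} {0} {x} 0<x′ 0<x′
        where
        0<x′ : 0 < s * Δ
        0<x′ = ℕ.*-mono-< {0} {s} {0} {Δ} 0<s (ℕ.<-≤-trans 0<δ δ≤Δ)
      main : δ * (e * e) + Δ * (x * x) ≤ δ * (2 * (e * x))
      main = ℕ.+-cancelˡ-≤ (s * 2 * δ * (r * (Δ * Δ))) _ _ (begin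
        s * 2 * δ * (r * (Δ * Δ)) + (δ * (e * e) + Δ * (x * x))
          ≡⟨ solve 5 (λ s r δ Δ e → s :* con 2 :* δ :* (r :* (Δ :* Δ)) :+ (δ :* (e :* e) :+ Δ :* (s :* Δ :* (s :* Δ)))
               := s :* con 2 :* δ :* (r :* (Δ :* Δ)) :+ δ :* (e :* e) :+ s :* (s :* (Δ :* Δ :* Δ))) refl s r δ Δ e ⟩
        s * 2 * δ * (r * (Δ * Δ)) + δ * (e * e) + s * (s * (Δ * Δ * Δ))
          ≤⟨ hyp ⟩
        s * 2 * δ * Z
          ≤⟨ ℕ.*-monoʳ-≤ (s * 2 * δ) Z≤ ⟩
        s * 2 * δ * (r * (Δ * Δ) + Δ * e)
          ≡⟨ solve 5 (λ s r δ Δ e → s :* con 2 :* δ :* (r :* (Δ :* Δ) :+ Δ :* e)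
               := s :* con 2 :* δ :* (r :* (Δ :* Δ)) :+ δ :* (con 2 :* (e :* (s :* Δ)))) refl s r δ Δ e ⟩
        s * 2 * δ * (r * (Δ * Δ)) + δ * (2 * (e * x)) ∎)
      Δ≤δ : Δ ≤ δ
      Δ≤δ = ℕ.*-cancelʳ-≤ Δ δ (x * x) {{ℕ.>-nonZero 0<x}} (ℕ.+-cancelˡ-≤ (δ * (e * e)) _ _ (begin
        δ * (e * e) + Δ * (x * x)  ≤⟨ main ⟩
        δ * (2 * (e * x))          ≤⟨ ℕ.*-monoʳ-≤ δ (2xy≤x²+y² e x) ⟩
        δ * (e * e + x * x)        ≡⟨ ℕ.*-distribˡ-+ δ (e * e) (x * x) ⟩
        δ * (e * e) + δ * (x * x)  ∎))

    -- Of the 2 s² δ³ on the right, one half completes s r δ³ to s n δ³ and the other half is δ (s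
    -- δ)². What remains is s F + δ e² ≤ s n δ³ + δ (s δ)², where each term on the left is at least
    -- its counterpart.
    forgotten-tight : ∀ {n e δ F s r} → 0 < δ → 0 < s → n ≡ s + r → s * δ ≤ e → n * (δ * δ * δ) ≤ F →
      s * F + δ * (e * e) ≤ s * (r * (δ * δ * δ)) + δ * (s * s * 2 * (δ * δ)) →
      e ≡ s * δ × F ≤ n * (δ * δ * δ)
    forgotten-tight {_} {e} {δ} {F} {s} {r} 0<δ 0<s refl sδ≤e ≤F hyp = ℕ.≤-antisym e≤sδ sδ≤e ,
      ℕ.*-cancelˡ-≤ s {{ℕ.>-nonZero 0<s}} (ℕ.+-cancelʳ-≤ (δ * (x * x)) _ _ (begin
        s * F + δ * (x * x)                ≤⟨ ℕ.+-monoʳ-≤ (s * F) (ℕ.*-monoʳ-≤ δ (ℕ.*-mono-≤ sδ≤e sδ≤e)) ⟩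
        s * F + δ * (e * e)                ≤⟨ hyp ⟩
        s * (r * (δ * δ * δ)) + δ * (s * s * 2 * (δ * δ)) ≡⟨ regroup ⟩
        s * ((s + r) * (δ * δ * δ)) + δ * (x * x) ∎))
      where
      x : ℕ
      x = s * δ
      regroup : s * (r * (δ * δ * δ)) + δ * (s * s * 2 * (δ * δ)) ≡ s * ((s + r) * (δ * δ * δ)) + δ * (x * x)
      regroup = solve 3 (λ s r δ → s :* (r :* (δ :* δ :* δ)) :+ δ :* (s :* s :* con 2 :* (δ :* δ))
        := s :* ((s :+ r) :* (δ :* δ :* δ)) :+ δ :* (s :* δ :* (s :* δ))) refl s r δ
      e≤sδ : e ≤ s * δ
      e≤sδ = square-cancel-≤ e x (ℕ.*-cancelˡ-≤ δ {{ℕ.>-nonZero 0<δ}}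
        (ℕ.+-cancelˡ-≤ (s * ((s + r) * (δ * δ * δ))) _ _ (begin
          s * ((s + r) * (δ * δ * δ)) + δ * (e * e) ≤⟨ ℕ.+-monoˡ-≤ _ (ℕ.*-monoʳ-≤ s ≤F) ⟩
          s * F + δ * (e * e)                       ≤⟨ hyp ⟩
          s * (r * (δ * δ * δ)) + δ * (s * s * 2 * (δ * δ)) ≡⟨ regroup ⟩
          s * ((s + r) * (δ * δ * δ)) + δ * (x * x) ∎)))

    -- After cancelling s Δ² r the hypothesis reads (s Δ)² + e² ≤ 2 (s δ)², while both s Δ and e are
    -- at least s δ.
    inverse-tight : ∀ {n e δ Δ s r} → 0 < s → n ≡ s + r → δ ≤ Δ → s * δ ≤ e →
      s * (Δ * Δ * n) + e * e ≤ s * (Δ * Δ * r) + s * s * 2 * (δ * δ) →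
      Δ ≤ δ × e ≡ s * δ
    inverse-tight {_} {e} {δ} {Δ} {s} {r} 0<s refl δ≤Δ sδ≤e hyp =
      ℕ.*-cancelˡ-≤ s {{ℕ.>-nonZero 0<s}} (square-cancel-≤ y x (ℕ.+-cancelʳ-≤ (x * x) _ _ (begin
        y * y + x * x ≤⟨ ℕ.+-monoʳ-≤ (y * y) (ℕ.*-mono-≤ sδ≤e sδ≤e) ⟩
        y * y + e * e ≤⟨ main ⟩
        x * x + x * x ∎))) ,
      ℕ.≤-antisym (square-cancel-≤ e x (ℕ.+-cancelˡ-≤ (x * x) _ _ (begin
        x * x + e * e ≤⟨ ℕ.+-monoˡ-≤ (e * e) (ℕ.*-mono-≤ x≤y x≤y) ⟩
        y * y + e * e ≤⟨ main ⟩
        x * x + x * x ∎))) sδ≤e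
      where
      x y : ℕ
      x = s * δ
      y = s * Δ
      x≤y : x ≤ y
      x≤y = ℕ.*-monoʳ-≤ s δ≤Δ
      main : y * y + e * e ≤ x * x + x * x
      main = ℕ.+-cancelˡ-≤ (s * (Δ * Δ * r)) _ _ (begin
        s * (Δ * Δ * r) + (y * y + e * e)
          ≡⟨ solve 4 (λ s r Δ e → s :* (Δ :* Δ :* r) :+ (s :* Δ :* (s :* Δ) :+ e :* e)
               := s :* (Δ :* Δ :* (s :+ r)) :+ e :* e) refl s r Δ e ⟩
        s * (Δ * Δ * (s + r)) + e * e
          ≤⟨ hyp ⟩
        s * (Δ * Δ * r) + s * s * 2 * (δ * δ)
          ≡⟨ solve 4 (λ s r δ Δ → s :* (Δ :* Δ :* r) :+ s :* s :* con 2 :* (δ :* δ)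
               := s :* (Δ :* Δ :* r) :+ (s :* δ :* (s :* δ) :+ s :* δ :* (s :* δ))) refl s r δ Δ ⟩
        s * (Δ * Δ * r) + (x * x + x * x) ∎)

open import Data.Rational.Base using (ℚ; 1ℚ; _+_; _-_; _*_; _≤_; _≥_)

-- Natural numbers inside the rationals

toℚᵘ-fromℕ : ∀ m → toℚᵘ (fromℕ m) ℚᵘ.≃ mkℚᵘ (ℤ.+ m) 0
toℚᵘ-fromℕ m = ℚ.toℚᵘ-fromℚᵘ (mkℚᵘ (ℤ.+ m) 0)

-- The detour through unnormalised rationals removes the division by a greatest common divisor,
-- which does not compute on variables; there both sides are fractions over 1.
fromℕ-+ : ∀ a b → fromℕ (a ℕ.+ b) ≡ fromℕ a + fromℕ b
fromℕ-+ a b = ℚ.toℚᵘ-injective (begin-equality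
  toℚᵘ (fromℕ (a ℕ.+ b))                  ≃⟨ toℚᵘ-fromℕ (a ℕ.+ b) ⟩
  mkℚᵘ (ℤ.+ (a ℕ.+ b)) 0                  ≃⟨ ℚᵘ.*≡* (cong (ℤ._* ℤ.+ 1) (trans (ℤ.pos-+ a b)
                                               (sym (cong₂ ℤ._+_ (ℤ.*-identityʳ (ℤ.+ a)) (ℤ.*-identityʳ (ℤ.+ b)))))) ⟩
  mkℚᵘ (ℤ.+ a) 0 ℚᵘ.+ mkℚᵘ (ℤ.+ b) 0      ≃⟨ ℚᵘ.+-cong (toℚᵘ-fromℕ a) (toℚᵘ-fromℕ b) ⟨
  toℚᵘ (fromℕ a) ℚᵘ.+ toℚᵘ (fromℕ b)      ≃⟨ ℚ.toℚᵘ-homo-+ (fromℕ a) (fromℕ b) ⟨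
  toℚᵘ (fromℕ a + fromℕ b)                ∎)
  where open ℚᵘ.≤-Reasoning

fromℕ-* : ∀ a b → fromℕ (a ℕ.* b) ≡ fromℕ a * fromℕ b
fromℕ-* a b = ℚ.toℚᵘ-injective (begin-equality
  toℚᵘ (fromℕ (a ℕ.* b))                  ≃⟨ toℚᵘ-fromℕ (a ℕ.* b) ⟩
  mkℚᵘ (ℤ.+ (a ℕ.* b)) 0                  ≃⟨ ℚᵘ.*≡* (cong (ℤ._* ℤ.+ 1) (ℤ.pos-* a b)) ⟩
  mkℚᵘ (ℤ.+ a) 0 ℚᵘ.* mkℚᵘ (ℤ.+ b) 0      ≃⟨ ℚᵘ.*-cong (toℚᵘ-fromℕ a) (toℚᵘ-fromℕ b) ⟨
  toℚᵘ (fromℕ a) ℚᵘ.* toℚᵘ (fromℕ b)      ≃⟨ ℚ.toℚᵘ-homo-* (fromℕ a) (fromℕ b) ⟨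
  toℚᵘ (fromℕ a * fromℕ b)                ∎)
  where open ℚᵘ.≤-Reasoning

fromℕ-mono-≤ : ∀ {a b} → a ℕ.≤ b → fromℕ a ≤ fromℕ b
fromℕ-mono-≤ {a} {b} a≤b = ℚ.toℚᵘ-cancel-≤ (begin
  toℚᵘ (fromℕ a)  ≃⟨ toℚᵘ-fromℕ a ⟩
  mkℚᵘ (ℤ.+ a) 0  ≤⟨ ℚᵘ.*≤* (ℤ.*-monoʳ-≤-nonNeg (ℤ.+ 1) (ℤ.+≤+ a≤b)) ⟩
  mkℚᵘ (ℤ.+ b) 0  ≃⟨ toℚᵘ-fromℕ b ⟨
  toℚᵘ (fromℕ b)  ∎)
  where open ℚᵘ.≤-Reasoning

fromℕ-cancel-≤ : ∀ {a b} → fromℕ a ≤ fromℕ b → a ℕ.≤ b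
fromℕ-cancel-≤ {a} {b} a≤b = unwrap (begin
  mkℚᵘ (ℤ.+ a) 0  ≃⟨ toℚᵘ-fromℕ a ⟨
  toℚᵘ (fromℕ a)  ≤⟨ ℚ.toℚᵘ-mono-≤ a≤b ⟩
  toℚᵘ (fromℕ b)  ≃⟨ toℚᵘ-fromℕ b ⟩
  mkℚᵘ (ℤ.+ b) 0  ∎)
  where
  open ℚᵘ.≤-Reasoning
  unwrap : mkℚᵘ (ℤ.+ a) 0 ℚᵘ.≤ mkℚᵘ (ℤ.+ b) 0 → a ℕ.≤ b
  unwrap (ℚᵘ.*≤* p) = ℤ.drop‿+≤+ (ℤ.*-cancelʳ-≤-pos (ℤ.+ a) (ℤ.+ b) (ℤ.+ 1) p)

fromℕ-nonNeg : ∀ m → ℚ.NonNegative (fromℕ m)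
fromℕ-nonNeg m = ℚ.nonNegative (fromℕ-mono-≤ {0} {m} z≤n)

fromℕ-≢0 : ∀ {m} → 0 ℕ.< m → fromℕ m ≢ 0ℚ
fromℕ-≢0 {m} 0<m eq = ℕ.<⇒≱ 0<m (fromℕ-cancel-≤ {m} {0} (ℚ.≤-reflexive eq))

fromℕ-pos : ∀ {m} → 0 ℕ.< m → ℚ.Positive (fromℕ m)
fromℕ-pos {m} 0<m = ℚ.positive (ℚ.≰⇒> λ m≤0 → ℕ.<⇒≱ 0<m (fromℕ-cancel-≤ {m} {0} m≤0))

-- fromℕ a ≡ x as a record, so that a and x are inferred from the type of a proof.
infix 4 _↦_
record _↦_ (a : ℕ) (x : ℚ) : Set where
  constructor cast
  field fromℕ≡ : fromℕ a ≡ x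

ν : ∀ a → a ↦ fromℕ a
ν a = cast refl

infixl 6 _⊞_
infixl 7 _⊠_

_⊞_ : ∀ {a b x y} → a ↦ x → b ↦ y → a ℕ.+ b ↦ x + y
_⊞_ {a} {b} (cast refl) (cast refl) = cast (fromℕ-+ a b)

_⊠_ : ∀ {a b x y} → a ↦ x → b ↦ y → a ℕ.* b ↦ x * y
_⊠_ {a} {b} (cast refl) (cast refl) = cast (fromℕ-* a b)

↦-cancel-≤ : ∀ {a b x y} → a ↦ x → b ↦ y → x ≤ y → a ℕ.≤ b
↦-cancel-≤ (cast refl) (cast refl) = fromℕ-cancel-≤

↦-mono-≤ : ∀ {a b x y} → a ↦ x → b ↦ y → a ℕ.≤ b → x ≤ y
↦-mono-≤ (cast refl) (cast refl) = fromℕ-mono-≤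

↦-≢0 : ∀ {a x} → a ↦ x → 0 ℕ.< a → x ≢ 0ℚ
↦-≢0 (cast refl) = fromℕ-≢0

scale : ∀ {a x p q} → a ↦ x → p ≤ q → x * p ≤ x * q
scale {a} (cast refl) = ℚ.*-monoˡ-≤-nonNeg (fromℕ a) {{fromℕ-nonNeg a}}

-- Clearing denominators

÷₀-* : ∀ p {q} → q ≢ 0ℚ → (p ÷₀ q) * q ≡ p
÷₀-* p {q} q≢0 with q ℚ.≟ 0ℚ
... | yes q≡0 = contradiction q≡0 q≢0
... | no  _   = trans (ℚ.*-assoc p _ q)
  (trans (cong (p *_) (ℚ.*-inverseˡ q {{ℚ.≢-nonZero q≢0}})) (ℚ.*-identityʳ p))

-- A zero divisor is harmless, since the quotient is then 0 by convention; the bound thus applies to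
-- e²/r with no proof that r is positive.
÷₀-≤ : ∀ {a x p q} → a ↦ x → 0ℚ ≤ q → p ≤ q * x → p ÷₀ x ≤ q
÷₀-≤ {zero}  {p = p} {q} (cast refl) 0≤q _    = 0≤q
÷₀-≤ {suc a} {p = p} {q} (cast refl) _   p≤qx = ℚ.*-cancelʳ-≤-pos (fromℕ (suc a)) {{fromℕ-pos {suc a} (s≤s z≤n)}}
  (ℚ.≤-trans (ℚ.≤-reflexive (÷₀-* p (fromℕ-≢0 {suc a} (s≤s z≤n)))) p≤qx)

≤-swap-minus : ∀ {a} b c d → a ≤ b + (c - d) → a + d ≤ b + c
≤-swap-minus {a} b c d a≤ = begin
  a + d            ≤⟨ ℚ.+-monoˡ-≤ d a≤ ⟩
  b + (c - d) + d  ≡⟨ solve 3 (λ b c d → b :+ (c :- d) :+ d := b :+ c) refl b c d ⟩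
  b + c            ∎
  where
  open ℚ.≤-Reasoning
  open Data.Rational.Solver.+-*-Solver

-- With `x` = Δ and `f` the reciprocal degrees this is n ≤ Δ Inv. The sum enters as a variable with
-- an equation, so that `inverseDegree G` can stand there unexpanded.
n≤x*sum : ∀ {n} (f : Fin n → ℚ) x Σf → (∀ i → 1ℚ ≤ x * f i) →
  Σf ≡ CommutativeMonoidSum.sum ℚ.+-0-commutativeMonoid f → fromℕ n ≤ x * Σf
n≤x*sum {zero}  f x _ _  refl = ℚ.≤-reflexive (sym (ℚ.*-zeroʳ x))
n≤x*sum {suc n} f x _ 1≤ refl = begin
  fromℕ (1 ℕ.+ n)       ≡⟨ fromℕ-+ 1 n ⟩
  1ℚ + fromℕ n          ≤⟨ ℚ.+-mono-≤ (1≤ zero) (n≤x*sum (f ∘ suc) x Σtail (1≤ ∘ suc) refl) ⟩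
  x * f zero + x * Σtail ≡⟨ ℚ.*-distribˡ-+ x (f zero) Σtail ⟨
  x * (f zero + Σtail)  ∎
  where
  open ℚ.≤-Reasoning
  Σtail : ℚ
  Σtail = CommutativeMonoidSum.sum ℚ.+-0-commutativeMonoid (f ∘ suc)

1≤Δ*1÷d : ∀ {d Δ} → 0 ℕ.< d → d ℕ.≤ Δ → 1ℚ ≤ fromℕ Δ * (1ℚ ÷₀ fromℕ d)
1≤Δ*1÷d {d} {Δ} 0<d d≤Δ = ℚ.*-cancelʳ-≤-pos (fromℕ d) {{fromℕ-pos 0<d}} (begin
  1ℚ * fromℕ d                           ≡⟨ ℚ.*-identityˡ (fromℕ d) ⟩
  fromℕ d                                ≤⟨ fromℕ-mono-≤ d≤Δ ⟩
  fromℕ Δ                                ≡⟨ ℚ.*-identityʳ (fromℕ Δ) ⟨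
  fromℕ Δ * 1ℚ                           ≡⟨ cong (fromℕ Δ *_) (÷₀-* 1ℚ (fromℕ-≢0 0<d)) ⟨
  fromℕ Δ * ((1ℚ ÷₀ fromℕ d) * fromℕ d)  ≡⟨ ℚ.*-assoc (fromℕ Δ) _ (fromℕ d) ⟨
  fromℕ Δ * (1ℚ ÷₀ fromℕ d) * fromℕ d    ∎)
  where open ℚ.≤-Reasoning

-- The rational quantities are variables and not terms fromℕ m: comparing types in which the
-- arithmetic of such terms unfolds is infeasible.
module Clearing {t s r e δ Δ : ℚ} {s₀ r₀ e₀ δ₀ Δ₀ : ℕ}
  (t↦ : 2 ↦ t) (s↦ : s₀ ↦ s) (r↦ : r₀ ↦ r) (e↦ : e₀ ↦ e) (δ↦ : δ₀ ↦ δ) (Δ↦ : Δ₀ ↦ Δ)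
  (0<s : 0 ℕ.< s₀) (0<δ : 0 ℕ.< δ₀) (0<Δ : 0 ℕ.< Δ₀) where
  open ℚ.≤-Reasoning
  open Data.Rational.Solver.+-*-Solver

  0<* : ∀ {a b} → 0 ℕ.< a → 0 ℕ.< b → 0 ℕ.< a ℕ.* b
  0<* {a} {b} 0<a 0<b = ℕ.*-mono-< {0} {a} {0} {b} 0<a 0<b

  s≢0 : s ≢ 0ℚ
  s≢0 = ↦-≢0 s↦ 0<s

  Δ≢0 : Δ ≢ 0ℚ
  Δ≢0 = ↦-≢0 Δ↦ 0<Δ

  sΔ³≢0 : s * (Δ * Δ * Δ) ≢ 0ℚ
  sΔ³≢0 = ↦-≢0 (s↦ ⊠ (Δ↦ ⊠ Δ↦ ⊠ Δ↦)) (0<* 0<s (0<* (0<* 0<Δ 0<Δ) 0<Δ))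

  -- The multiplier s t δ is a common multiple of the denominators t s and t δ. The two quotients
  -- are generalised to `x` and `y`, of which only the defining equations are kept.
  zagreb-cleared : ∀ {Z Z₀} → Z₀ ↦ Z →
    Z ≥ r * (Δ * Δ) + (e * e) ÷₀ (t * s) + (s * (Δ * Δ * Δ)) ÷₀ (t * δ) →
    s₀ ℕ.* 2 ℕ.* δ₀ ℕ.* (r₀ ℕ.* (Δ₀ ℕ.* Δ₀)) ℕ.+ δ₀ ℕ.* (e₀ ℕ.* e₀) ℕ.+ s₀ ℕ.* (s₀ ℕ.* (Δ₀ ℕ.* Δ₀ ℕ.* Δ₀)) ℕ.≤ s₀ ℕ.* 2 ℕ.* δ₀ ℕ.* Z₀
  zagreb-cleared {Z} {Z₀} Z↦ = clear _ _
    (÷₀-* (e * e) (↦-≢0 (t↦ ⊠ s↦) (0<* {2} (s≤s z≤n) 0<s)))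
    (÷₀-* (s * (Δ * Δ * Δ)) (↦-≢0 (t↦ ⊠ δ↦) (0<* {2} (s≤s z≤n) 0<δ)))
    where
    clear : ∀ x y → x * (t * s) ≡ e * e → y * (t * δ) ≡ s * (Δ * Δ * Δ) → Z ≥ r * (Δ * Δ) + x + y →
      s₀ ℕ.* 2 ℕ.* δ₀ ℕ.* (r₀ ℕ.* (Δ₀ ℕ.* Δ₀)) ℕ.+ δ₀ ℕ.* (e₀ ℕ.* e₀) ℕ.+ s₀ ℕ.* (s₀ ℕ.* (Δ₀ ℕ.* Δ₀ ℕ.* Δ₀)) ℕ.≤ s₀ ℕ.* 2 ℕ.* δ₀ ℕ.* Z₀
    clear x y x≡ y≡ hyp = ↦-cancel-≤
      (s↦ ⊠ t↦ ⊠ δ↦ ⊠ (r↦ ⊠ (Δ↦ ⊠ Δ↦)) ⊞ δ↦ ⊠ (e↦ ⊠ e↦) ⊞ s↦ ⊠ (s↦ ⊠ (Δ↦ ⊠ Δ↦ ⊠ Δ↦))) (s↦ ⊠ t↦ ⊠ δ↦ ⊠ Z↦) (begin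
      s * t * δ * (r * (Δ * Δ)) + δ * (e * e) + s * (s * (Δ * Δ * Δ))
        ≡⟨ cong₂ (λ a b → s * t * δ * (r * (Δ * Δ)) + δ * a + s * b) x≡ y≡ ⟨
      s * t * δ * (r * (Δ * Δ)) + δ * (x * (t * s)) + s * (y * (t * δ))
        ≡⟨ solve 6 (λ s t δ R x y → s :* t :* δ :* R :+ δ :* (x :* (t :* s)) :+ s :* (y :* (t :* δ))
             := s :* (t :* (δ :* (R :+ x :+ y)))) refl s t δ (r * (Δ * Δ)) x y ⟩
      s * (t * (δ * (r * (Δ * Δ) + x + y)))
        ≤⟨ scale s↦ (scale t↦ (scale δ↦ hyp)) ⟩
      s * (t * (δ * Z))
        ≡⟨ solve 4 (λ s t δ Z → s :* (t :* (δ :* Z)) := s :* t :* δ :* Z) refl s t δ Z ⟩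
      s * t * δ * Z ∎)

  e²÷r≤rΔ² : e₀ ℕ.≤ r₀ ℕ.* Δ₀ → (e * e) ÷₀ r ≤ r * (Δ * Δ)
  e²÷r≤rΔ² e≤rΔ = ÷₀-≤ r↦ (↦-mono-≤ (ν 0) (r↦ ⊠ (Δ↦ ⊠ Δ↦)) z≤n) (begin
    e * e              ≤⟨ ↦-mono-≤ (e↦ ⊠ e↦) (r↦ ⊠ Δ↦ ⊠ (r↦ ⊠ Δ↦)) (ℕ.*-mono-≤ e≤rΔ e≤rΔ) ⟩
    r * Δ * (r * Δ)    ≡⟨ solve 2 (λ r Δ → r :* Δ :* (r :* Δ) := r :* (Δ :* Δ) :* r) refl r Δ ⟩
    r * (Δ * Δ) * r    ∎)

  -- The two sides differ by 2 s (e²/r - r Δ²), which is at most 0. Hence the third condition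
  -- implies the second, and the fifth implies the fourth.
  bracket≤ : e₀ ℕ.≤ r₀ ℕ.* Δ₀ →
    t * s * (s * (δ * δ) + (e * e) ÷₀ r) - e * e - t * s * r * (Δ * Δ) ≤ t * (s * s) * (δ * δ) - e * e
  bracket≤ e≤rΔ = compare ((e * e) ÷₀ r) (e²÷r≤rΔ² e≤rΔ)
    where
    compare : ∀ q → q ≤ r * (Δ * Δ) →
      t * s * (s * (δ * δ) + q) - e * e - t * s * r * (Δ * Δ) ≤ t * (s * s) * (δ * δ) - e * e
    compare q q≤ = begin
      t * s * (s * (δ * δ) + q) - e * e - t * s * r * (Δ * Δ)
        ≡⟨ solve 7 (λ t s δ q e r Δ → t :* s :* (s :* (δ :* δ) :+ q) :- e :* e :- t :* s :* r :* (Δ :* Δ)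
             := (t :* (s :* s) :* (δ :* δ) :- e :* e :- t :* (s :* (r :* (Δ :* Δ)))) :+ t :* (s :* q))
             refl t s δ q e r Δ ⟩
      (t * (s * s) * (δ * δ) - e * e - t * (s * (r * (Δ * Δ)))) + t * (s * q)
        ≤⟨ ℚ.+-monoʳ-≤ (t * (s * s) * (δ * δ) - e * e - t * (s * (r * (Δ * Δ)))) (scale t↦ (scale s↦ q≤)) ⟩
      (t * (s * s) * (δ * δ) - e * e - t * (s * (r * (Δ * Δ)))) + t * (s * (r * (Δ * Δ)))
        ≡⟨ solve 2 (λ Y c → Y :- c :+ c := Y) refl (t * (s * s) * (δ * δ) - e * e) (t * (s * (r * (Δ * Δ)))) ⟩
      t * (s * s) * (δ * δ) - e * e ∎

  forgotten-cleared : ∀ {F F₀} → F₀ ↦ F → s * F ≤ s * (r * (δ * δ * δ)) + δ * (t * (s * s) * (δ * δ) - e * e) →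
    s₀ ℕ.* F₀ ℕ.+ δ₀ ℕ.* (e₀ ℕ.* e₀) ℕ.≤ s₀ ℕ.* (r₀ ℕ.* (δ₀ ℕ.* δ₀ ℕ.* δ₀)) ℕ.+ δ₀ ℕ.* (s₀ ℕ.* s₀ ℕ.* 2 ℕ.* (δ₀ ℕ.* δ₀))
  forgotten-cleared {F} F↦ hyp = ↦-cancel-≤
    (s↦ ⊠ F↦ ⊞ δ↦ ⊠ (e↦ ⊠ e↦)) (s↦ ⊠ (r↦ ⊠ (δ↦ ⊠ δ↦ ⊠ δ↦)) ⊞ δ↦ ⊠ (s↦ ⊠ s↦ ⊠ t↦ ⊠ (δ↦ ⊠ δ↦)))
    (≤-swap-minus (s * (r * (δ * δ * δ))) (δ * (s * s * t * (δ * δ))) (δ * (e * e)) (begin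
      s * F
        ≤⟨ hyp ⟩
      s * (r * (δ * δ * δ)) + δ * (t * (s * s) * (δ * δ) - e * e)
        ≡⟨ cong (s * (r * (δ * δ * δ)) +_) (solve 4 (λ δ t s e → δ :* (t :* (s :* s) :* (δ :* δ) :- e :* e)
             := δ :* (s :* s :* t :* (δ :* δ)) :- δ :* (e :* e)) refl δ t s e) ⟩
      s * (r * (δ * δ * δ)) + (δ * (s * s * t * (δ * δ)) - δ * (e * e)) ∎))

  forgotten-scaled₁ : ∀ F Y → F ≤ r * (δ * δ * δ) + (δ * Y) ÷₀ s →
    s * F ≤ s * (r * (δ * δ * δ)) + δ * Y
  forgotten-scaled₁ F Y hyp = begin
    s * F
      ≤⟨ scale s↦ hyp ⟩
    s * (r * (δ * δ * δ) + (δ * Y) ÷₀ s)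
      ≡⟨ ℚ.*-distribˡ-+ s (r * (δ * δ * δ)) _ ⟩
    s * (r * (δ * δ * δ)) + s * ((δ * Y) ÷₀ s)
      ≡⟨ cong (s * (r * (δ * δ * δ)) +_) (trans (ℚ.*-comm s _) (÷₀-* (δ * Y) s≢0)) ⟩
    s * (r * (δ * δ * δ)) + δ * Y ∎

  forgotten-scaled₂ : ∀ F X Y → X ≤ Y → F ≤ r * (δ * δ * δ) + (δ ÷₀ s) * X →
    s * F ≤ s * (r * (δ * δ * δ)) + δ * Y
  forgotten-scaled₂ F X Y X≤Y hyp = begin
    s * F
      ≤⟨ scale s↦ hyp ⟩
    s * (r * (δ * δ * δ) + (δ ÷₀ s) * X)
      ≡⟨ solve 4 (λ s R q X → s :* (R :+ q :* X) := s :* R :+ q :* s :* X) refl s (r * (δ * δ * δ)) (δ ÷₀ s) X ⟩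
    s * (r * (δ * δ * δ)) + (δ ÷₀ s) * s * X
      ≡⟨ cong (λ a → s * (r * (δ * δ * δ)) + a * X) (÷₀-* δ s≢0) ⟩
    s * (r * (δ * δ * δ)) + δ * X
      ≤⟨ ℚ.+-monoʳ-≤ (s * (r * (δ * δ * δ))) (scale δ↦ X≤Y) ⟩
    s * (r * (δ * δ * δ)) + δ * Y ∎

  inverse-cleared : ∀ n I → fromℕ n ≤ Δ * I → s * (Δ * Δ * Δ) * I ≤ s * (Δ * Δ * r) + (t * (s * s) * (δ * δ) - e * e) →
    s₀ ℕ.* (Δ₀ ℕ.* Δ₀ ℕ.* n) ℕ.+ e₀ ℕ.* e₀ ℕ.≤ s₀ ℕ.* (Δ₀ ℕ.* Δ₀ ℕ.* r₀) ℕ.+ s₀ ℕ.* s₀ ℕ.* 2 ℕ.* (δ₀ ℕ.* δ₀)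
  inverse-cleared n I n≤ΔI hyp = ↦-cancel-≤
    (s↦ ⊠ (Δ↦ ⊠ Δ↦ ⊠ ν n) ⊞ e↦ ⊠ e↦) (s↦ ⊠ (Δ↦ ⊠ Δ↦ ⊠ r↦) ⊞ s↦ ⊠ s↦ ⊠ t↦ ⊠ (δ↦ ⊠ δ↦))
    (≤-swap-minus (s * (Δ * Δ * r)) (s * s * t * (δ * δ)) (e * e) (begin
      s * (Δ * Δ * fromℕ n)
        ≡⟨ cong (s *_) (ℚ.*-assoc Δ Δ (fromℕ n)) ⟩
      s * (Δ * (Δ * fromℕ n))
        ≤⟨ scale s↦ (scale Δ↦ (scale Δ↦ n≤ΔI)) ⟩
      s * (Δ * (Δ * (Δ * I)))
        ≡⟨ solve 3 (λ s Δ I → s :* (Δ :* (Δ :* (Δ :* I))) := s :* (Δ :* Δ :* Δ) :* I) refl s Δ I ⟩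
      s * (Δ * Δ * Δ) * I
        ≤⟨ hyp ⟩
      s * (Δ * Δ * r) + (t * (s * s) * (δ * δ) - e * e)
        ≡⟨ cong (λ a → s * (Δ * Δ * r) + (a * (δ * δ) - e * e)) (ℚ.*-comm t (s * s)) ⟩
      s * (Δ * Δ * r) + (s * s * t * (δ * δ) - e * e) ∎))

  inverse-scaled : ∀ I Q → I ≤ r ÷₀ Δ + Q →
    s * (Δ * Δ * Δ) * I ≤ s * (Δ * Δ * r) + Q * (s * (Δ * Δ * Δ))
  inverse-scaled I Q hyp = begin
    s * (Δ * Δ * Δ) * I
      ≡⟨ solve 3 (λ s Δ I → s :* (Δ :* Δ :* Δ) :* I := s :* (Δ :* (Δ :* (Δ :* I)))) refl s Δ I ⟩
    s * (Δ * (Δ * (Δ * I)))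
      ≤⟨ scale s↦ (scale Δ↦ (scale Δ↦ (scale Δ↦ hyp))) ⟩
    s * (Δ * (Δ * (Δ * (r ÷₀ Δ + Q))))
      ≡⟨ solve 4 (λ s Δ q Q → s :* (Δ :* (Δ :* (Δ :* (q :+ Q)))) := s :* (Δ :* Δ :* (q :* Δ)) :+ Q :* (s :* (Δ :* Δ :* Δ)))
           refl s Δ (r ÷₀ Δ) Q ⟩
    s * (Δ * Δ * (r ÷₀ Δ * Δ)) + Q * (s * (Δ * Δ * Δ))
      ≡⟨ cong (λ a → s * (Δ * Δ * a) + Q * (s * (Δ * Δ * Δ))) (÷₀-* r Δ≢0) ⟩
    s * (Δ * Δ * r) + Q * (s * (Δ * Δ * Δ)) ∎

  inverse-scaled₁ : ∀ I Y → I ≤ r ÷₀ Δ + Y ÷₀ (s * (Δ * Δ * Δ)) →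
    s * (Δ * Δ * Δ) * I ≤ s * (Δ * Δ * r) + Y
  inverse-scaled₁ I Y hyp = ℚ.≤-trans (inverse-scaled I (Y ÷₀ (s * (Δ * Δ * Δ))) hyp)
    (ℚ.≤-reflexive (cong (s * (Δ * Δ * r) +_) (÷₀-* Y sΔ³≢0)))

  inverse-scaled₂ : ∀ I X Y → X ≤ Y → I ≤ r ÷₀ Δ + (1ℚ ÷₀ (s * (Δ * Δ * Δ))) * X →
    s * (Δ * Δ * Δ) * I ≤ s * (Δ * Δ * r) + Y
  inverse-scaled₂ I X Y X≤Y hyp = begin
    s * (Δ * Δ * Δ) * I
      ≤⟨ inverse-scaled I ((1ℚ ÷₀ (s * (Δ * Δ * Δ))) * X) hyp ⟩
    s * (Δ * Δ * r) + (1ℚ ÷₀ (s * (Δ * Δ * Δ))) * X * (s * (Δ * Δ * Δ))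
      ≡⟨ cong (s * (Δ * Δ * r) +_) (cancel (1ℚ ÷₀ (s * (Δ * Δ * Δ))) (s * (Δ * Δ * Δ)) (÷₀-* 1ℚ sΔ³≢0)) ⟩
    s * (Δ * Δ * r) + X
      ≤⟨ ℚ.+-monoʳ-≤ (s * (Δ * Δ * r)) X≤Y ⟩
    s * (Δ * Δ * r) + Y ∎
    where
    cancel : ∀ q m → q * m ≡ 1ℚ → q * X * m ≡ X
    cancel q m qm≡1 = trans (solve 3 (λ q X m → q :* X :* m := q :* m :* X) refl q X m)
      (trans (cong (_* X) qm≡1) (ℚ.*-identityˡ X))

-- The five conditions applied to a graph

↦-minus : ∀ {n} a b c → a ℕ.+ b ℕ.+ c ≡ n → c ↦ fromℕ n - fromℕ a - fromℕ b
↦-minus a b c refl = cast (sym (trans (cong (λ x → x - fromℕ a - fromℕ b) (_↦_.fromℕ≡ (ν a ⊞ ν b ⊞ ν c)))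
  (cancel (fromℕ a) (fromℕ b) (fromℕ c))))
  where
  open Data.Rational.Solver.+-*-Solver
  cancel : ∀ x y z → x + y + z - x - y ≡ z
  cancel = solve 3 (λ x y z → x :+ y :+ z :- x :- y := z) refl

-- Stated for arbitrary rationals, so that the case analysis works with variables; its instance at
-- the invariants of the graph is the hypothesis of the theorem.
Condition : (two s r e δ Δ Z₁ F Inv : ℚ) → Set
Condition two s r e δ Δ Z₁ F Inv =
  ( Z₁ ≥ r * (Δ * Δ) + (e * e) ÷₀ (two * s) + (s * (Δ * Δ * Δ)) ÷₀ (two * δ)
  ⊎ F ≤ r * (δ * δ * δ) + (δ * (two * (s * s) * (δ * δ) - e * e)) ÷₀ s
  ⊎ F ≤ r * (δ * δ * δ) + (δ ÷₀ s) * (two * s * (s * (δ * δ) + (e * e) ÷₀ r) - e * e - two * s * r * (Δ * Δ))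
  ⊎ Inv ≤ r ÷₀ Δ + (two * (s * s) * (δ * δ) - e * e) ÷₀ (s * (Δ * Δ * Δ))
  ⊎ Inv ≤ r ÷₀ Δ + (1ℚ ÷₀ (s * (Δ * Δ * Δ))) * (two * s * (s * (δ * δ) + (e * e) ÷₀ r) - e * e - two * s * r * (Δ * Δ))
  )

-- Pure arithmetic: the graph enters only through the estimates listed before `Condition`.
condition-tight : ∀ {two s r e δ Δ Z₁ F Inv n s₀ r₀ e₀ δ₀ Δ₀ Z₀ F₀} →
  2 ↦ two → s₀ ↦ s → r₀ ↦ r → e₀ ↦ e → δ₀ ↦ δ → Δ₀ ↦ Δ → Z₀ ↦ Z₁ → F₀ ↦ F →
  0 ℕ.< s₀ → 0 ℕ.< δ₀ → δ₀ ℕ.≤ Δ₀ → n ≡ s₀ ℕ.+ r₀ →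
  s₀ ℕ.* δ₀ ℕ.≤ e₀ → e₀ ℕ.≤ r₀ ℕ.* Δ₀ → Z₀ ℕ.≤ r₀ ℕ.* (Δ₀ ℕ.* Δ₀) ℕ.+ Δ₀ ℕ.* e₀ →
  n ℕ.* (δ₀ ℕ.* δ₀ ℕ.* δ₀) ℕ.≤ F₀ → fromℕ n ≤ Δ * Inv →
  Condition two s r e δ Δ Z₁ F Inv →
  (Δ₀ ℕ.≤ δ₀ ⊎ F₀ ℕ.≤ n ℕ.* (δ₀ ℕ.* δ₀ ℕ.* δ₀)) × e₀ ≡ s₀ ℕ.* δ₀
condition-tight {two} {s} {r} {e} {δ} {Δ} {Z₁} {F} {Inv} {n} {s₀} {r₀} {e₀} {δ₀} {Δ₀} {Z₀} {F₀}
  t↦ s↦ r↦ e↦ δ↦ Δ↦ Z↦ F↦ 0<s 0<δ δ≤Δ n≡ sδ≤e e≤rΔ Z≤ ≤F n≤ΔInv = tight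
  where
  open Clearing t↦ s↦ r↦ e↦ δ↦ Δ↦ 0<s 0<δ (ℕ.<-≤-trans 0<δ δ≤Δ)

  Tight : Set
  Tight = (Δ₀ ℕ.≤ δ₀ ⊎ F₀ ℕ.≤ n ℕ.* (δ₀ ℕ.* δ₀ ℕ.* δ₀)) × e₀ ≡ s₀ ℕ.* δ₀

  F-tight : s * F ≤ s * (r * (δ * δ * δ)) + δ * (two * (s * s) * (δ * δ) - e * e) → Tight
  F-tight hyp = let e≡sδ , F≤ = forgotten-tight 0<δ 0<s n≡ sδ≤e ≤F (forgotten-cleared F↦ hyp)
                in inj₂ F≤ , e≡sδ

  Inv-tight : s * (Δ * Δ * Δ) * Inv ≤ s * (Δ * Δ * r) + (two * (s * s) * (δ * δ) - e * e) → Tight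
  Inv-tight hyp = let Δ≤δ , e≡sδ = inverse-tight 0<s n≡ δ≤Δ sδ≤e (inverse-cleared n Inv n≤ΔInv hyp)
                  in inj₁ Δ≤δ , e≡sδ

  tight : Condition two s r e δ Δ Z₁ F Inv → Tight
  tight (inj₁ hyp) = let Δ≤δ , e≡sΔ = zagreb-tight {r = r₀} 0<δ 0<s δ≤Δ Z≤ (zagreb-cleared Z↦ hyp)
                     in inj₁ Δ≤δ , trans e≡sΔ (cong (s₀ ℕ.*_) (ℕ.≤-antisym Δ≤δ δ≤Δ))
  tight (inj₂ (inj₁ hyp)) = F-tight
    (forgotten-scaled₁ F (two * (s * s) * (δ * δ) - e * e) hyp)
  tight (inj₂ (inj₂ (inj₁ hyp))) = F-tight
    (forgotten-scaled₂ F (two * s * (s * (δ * δ) + (e * e) ÷₀ r) - e * e - two * s * r * (Δ * Δ))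
      (two * (s * s) * (δ * δ) - e * e) (bracket≤ e≤rΔ) hyp)
  tight (inj₂ (inj₂ (inj₂ (inj₁ hyp)))) = Inv-tight
    (inverse-scaled₁ Inv (two * (s * s) * (δ * δ) - e * e) hyp)
  tight (inj₂ (inj₂ (inj₂ (inj₂ hyp)))) = Inv-tight
    (inverse-scaled₂ Inv (two * s * (s * (δ * δ) + (e * e) ÷₀ r) - e * e - two * s * r * (Δ * Δ))
      (two * (s * s) * (δ * δ) - e * e) (bracket≤ e≤rΔ) hyp)

independent⇒traceable : ∀ {n k} (G : Graph n) → k ℕ.≥ 1 → n ℕ.≥ 9 → Connected G k →
  ∀ I → length I ≡ 2 ℕ.+ k → ChvátalErdős.Independent G I → ∀ r → length I ℕ.+ r ≡ n →
  Condition (fromℕ 2) (fromℕ k + fromℕ 2) (fromℕ n - fromℕ k - fromℕ 2) (fromℕ (edgeCount G)) (fromℕ (minDegree G))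
    (fromℕ (maxDegree G)) (fromℕ (firstZagreb G)) (fromℕ (forgotten G)) (inverseDegree G) →
  Traceable G
independent⇒traceable {n} {k} G k≥1 n≥9 conn I s≡2+k independent r s+r≡n condition = extremal-traceable
  where
  open Degrees G
  open IndependentSet I independent
  -- From `k ≥ 1` the minimum degree is positive, so the divisions by degrees, by δ and by Δ are
  -- genuine.
  0<δ : 0 ℕ.< minDegree G
  0<δ = ℕ.≤-trans k≥1 (connected⇒≤minDegree conn)
  some-vertex : Fin n
  some-vertex = Fin.fromℕ< (ℕ.≤-trans (s≤s z≤n) n≥9)
  s↦ : s ↦ fromℕ k + fromℕ 2
  s↦ = subst (_↦ fromℕ k + fromℕ 2) (trans (ℕ.+-comm k 2) (sym s≡2+k)) (ν k ⊞ ν 2)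
  -- The number `r` counts the vertices outside `I`, so the rational difference n - k - 2 is a
  -- natural number here.
  r↦ : r ↦ fromℕ n - fromℕ k - fromℕ 2
  r↦ = ↦-minus k 2 r (trans (cong (ℕ._+ r) (trans (ℕ.+-comm k 2) (sym s≡2+k))) s+r≡n)
  tight : (maxDegree G ℕ.≤ minDegree G ⊎ forgotten G ℕ.≤ n ℕ.* (minDegree G ℕ.* minDegree G ℕ.* minDegree G))
    × edgeCount G ≡ s ℕ.* minDegree G
  tight = condition-tight (ν 2) s↦ r↦ (ν (edgeCount G)) (ν (minDegree G)) (ν (maxDegree G)) (ν (firstZagreb G)) (ν (forgotten G))
    (subst (0 ℕ.<_) (sym s≡2+k) (s≤s z≤n)) 0<δ
    (ℕ.≤-trans (minDegree≤ some-vertex) (≤maxDegree some-vertex)) (sym s+r≡n) s*δ≤e (e≤r*Δ (sym s+r≡n))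
    (firstZagreb≤ (sym s+r≡n)) n*δ³≤forgotten
    (n≤x*sum (λ u → 1ℚ ÷₀ fromℕ (degree G u)) (fromℕ (maxDegree G)) (inverseDegree G)
      (λ u → 1≤Δ*1÷d (ℕ.<-≤-trans 0<δ (minDegree≤ u)) (≤maxDegree u)) refl)
    condition
  open Extremal k s≡2+k n≥9 conn 0<δ (tight⇒regular (proj₁ tight)) (proj₂ tight)

theorem3 : ∀ (n k : ℕ) (G : Graph n) → k ℕ.≥ 1 → n ℕ.≥ 9 → Connected G k →
    let e  = fromℕ (edgeCount G)
        δ  = fromℕ (minDegree G)
        Δ  = fromℕ (maxDegree G)
        Z₁ = fromℕ (firstZagreb G)
        F  = fromℕ (forgotten G)
        Inv = inverseDegree G
        two = fromℕ 2
        s  = fromℕ k + two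
        r  = fromℕ n - fromℕ k - two
    in
    ( Z₁ ≥ r * (Δ * Δ) + (e * e) ÷₀ (two * s) + (s * (Δ * Δ * Δ)) ÷₀ (two * δ)
    ⊎ F ≤ r * (δ * δ * δ) + (δ * (two * (s * s) * (δ * δ) - e * e)) ÷₀ s
    ⊎ F ≤ r * (δ * δ * δ) + (δ ÷₀ s) * (two * s * (s * (δ * δ) + (e * e) ÷₀ r) - e * e - two * s * r * (Δ * Δ))
    ⊎ Inv ≤ r ÷₀ Δ + (two * (s * s) * (δ * δ) - e * e) ÷₀ (s * (Δ * Δ * Δ))
    ⊎ Inv ≤ r ÷₀ Δ + (1ℚ ÷₀ (s * (Δ * Δ * Δ))) * (two * s * (s * (δ * δ) + (e * e) ÷₀ r) - e * e - two * s * r * (Δ * Δ))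
    ) → Traceable G
theorem3 n k G k≥1 n≥9 conn condition = [ id , (λ (I , s≡2+k , independent) →
  let r , s+r≡n = ℕ.m≤n⇒∃[o]m+o≡n (length-unique≤ (AllPairs.map proj₁ independent))
  in independent⇒traceable G k≥1 n≥9 conn I s≡2+k independent r s+r≡n condition) ]′
  (ChvátalErdős.chvátal-erdős G conn)
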